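{- The triple $\bigl((\mathrm{S}(E),\oplus_{\mathrm{S}(E)}),(\mathrm{M}(E),\oplus_{\mathrm{M}(E)}),h\bigr)$ characterizes $E$ up to isomorphism within the class of all TRT-effect algebras. That is: let $E$ and $F$ be TRT-effect algebras with associated triples $(\mathrm{S}(E),\mathrm{M}(E),h_E)$ and $(\mathrm{S}(F),\mathrm{M}(F),h_F)$. Then $E$ and $F$ are isomorphic as effect algebras if and only if their triples are isomorphic, i.e. if and only if there exist an isomorphism of effect algebras $\sigma:\mathrm{S}(E)\to \mathrm{S}(F)$ and an isomorphism of generalized effect algebras $\mu:\mathrm{M}(E)\to \mathrm{M}(F)$ such that $\mu(h_E(s))=h_F(\sigma(s))$ for every $s\in \mathrm{S}(E)$.
   Context: **Effect algebras.** An effect algebra is a partial algebra $(E;\oplus,0,1)$ with two distinct elements $0,1$ and a partial binary operation $\oplus$ such that for all $x,y,z\in E$: $x\oplus y=y\oplus x$ if $x\oplus y$ is defined; $(x\oplus y)\oplus z=x\oplus(y\oplus z)$ if one side is defined; for every $x$ there is a unique $y$ with $x\oplus y=1$ (written $y=x'$); if $1\oplus x$ is defined then $x=0$. A generalized effect algebra $(E;\oplus,0)$ has a partial binary operation $\oplus$ with: $x\oplus y=y\oplus x$ if one side is defined; $(x\oplus y)\oplus z=x\oplus(y\oplus z)$ if one side is defined; $x\oplus y=x\oplus z$ implies $y=z$; $x\oplus y=0$ implies $x=y=0$; $x\oplus 0=x$ for all $x$. In both cases put $x\le y$ and $y\ominus x=z$ iff $x\oplus z$ is defined and $x\oplus z=y$;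 $\le$ is a partial order, and $\wedge,\vee$ refer to meets and joins in this order. A sub-effect algebra of $E$ is a subset $Q$ with $1\in Q$ such that whenever $x\oplus y=z$ in $E$ and two of $x,y,z$ lie in $Q$, then all three do; it is an effect algebra with the inherited operation. A morphism of effect algebras preserves the unit and orthosums (if $x\oplus y$ is defined then $f(x)\oplus f(y)$ is defined and equals $f(x\oplus y)$); an isomorphism is a bijective morphism whose inverse is a morphism. An isomorphism of generalized effect algebras is a bijection preserving $0$ and such that $x\oplus y$ is defined iff $f(x)\oplus f(y)$ is, in which case $f(x\oplus y)=f(x)\oplus f(y)$. **Homogeneity and blocks.** $E$ has the Riesz decomposition property (RDP) if $u\le v_1\oplus v_2$ implies $u=u_1\oplus u_2$ for some $u_1\le v_1$, $u_2\le v_2$. $E$ is homogeneous if $u\le v_1\oplus v_2\le u'$ implies $u=u_1\oplus u_2$ for some $u_1\le v_1$, $u_2\le v_2$. A block of a homogeneous effect algebra $E$ is a maximal sub-effect algebra of $E$ with the RDP. **Sharp and meager elements.** $x\in E$ is sharp if $x\wedge x'=0$; $\mathrm{S}(E)$ is the set of sharp elements. $E$ is sharply dominating if for every $x\in E$ there is a smallest sharp element $\widehat{x}$ with $x\le\widehat{x}$; equivalently, for every $x$ there is a largest sharp element $\widetilde{x}$ with $\widetilde{x}\le x$. In a sharply dominating $E$, $\mathrm{S}(E)$ is a sub-effect algebra, with operation $\oplus_{\mathrm{S}(E)}$ the restriction of $\oplus$. The set of meager elements is $\mathrm{M}(E)=\{x\in E\mid \text{if } v\in \mathrm{S}(E)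 \text{ and } v\le x \text{ then } v=0\}$; it is a generalized effect algebra under $\oplus_{\mathrm{M}(E)}$, where $x\oplus_{\mathrm{M}(E)}y$ is defined iff $x\oplus y$ is defined in $E$ and $x\oplus y\in \mathrm{M}(E)$, in which case $x\oplus_{\mathrm{M}(E)}y=x\oplus y$; $\ominus_{\mathrm{M}(E)}$ is the corresponding difference. The map $h=h_E:\mathrm{S}(E)\to 2^{\mathrm{M}(E)}$ is $h(s)=\{x\in \mathrm{M}(E)\mid x\le s\}$. **TRT-effect algebras.** A TRT-effect algebra is a homogeneous sharply dominating effect algebra $E$ such that (1) for every block $B$ of $E$, $x\in B$ implies $[\widetilde{x},x]=\{z\in E\mid\widetilde{x}\le z\le x\}\subseteq B$; and (2) for every $x\in \mathrm{M}(E)$, the element $y=\widehat{x}\ominus x$ is the only element satisfying all of the following (assertions that an expression exists include the existence of its subexpressions and meets): (i) $y\in \mathrm{M}(E)$ and $\widehat{y}=\widehat{x}$; (ii) $x\oplus_{\mathrm{M}(E)}(y\ominus_{\mathrm{M}(E)}(x\wedge y))$ exists and belongs to $h(\widehat{x})$; (iii) for all $z\in h(\widehat{x})$: $z\oplus_{\mathrm{M}(E)}x$ exists and belongs to $h(\widehat{x})$ if and only if $z\le y$ and $\widehat{y\ominus_{\mathrm{M}(E)}z}=\widehat{x}$. -}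

module Defs where

open import Level using (Level; suc; Setω)
open import Axiom.ExcludedMiddle using (ExcludedMiddle)
open import Data.Product using (Σ; ∃; ∃!; ∃-syntax; _×_; _,_; proj₁; proj₂)
open import Data.Sum using (_⊎_; inj₁; inj₂)
open import Function.Base using (_on_)
open import Function.Bundles using (_⇔_)
open import Function.Definitions using (Congruent; Bijective; Inverseᵇ)
open import Relation.Binary.Bundles using (Poset)
open import Relation.Binary.Core using (Rel)
open import Relation.Binary.Definitions using (_Respects_)
open import Relation.Binary.Structures using (IsEquivalence)
open import Relation.Nullary using (¬_)
open import Relation.Unary using (Pred; _∈_; _⊆_; _≐_)

------------------------------------------------------------------------
-- Classical set theory

-- The mathematics formalised here lives in ZFC.  Blocks are maximal
-- subsets, and their existence depends on Zorn's lemma.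

module _ {a ℓ₁ ℓ₂} (P : Poset a ℓ₁ ℓ₂) where
  open Poset P

  IsChain : ∀ {c} → Pred Carrier c → Set _
  IsChain C = ∀ {x y} → x ∈ C → y ∈ C → x ≤ y ⊎ y ≤ x

  IsUpperBound : ∀ {c} → Pred Carrier c → Carrier → Set _
  IsUpperBound C u = ∀ {x} → x ∈ C → x ≤ u

  IsMaximal : Carrier → Set _
  IsMaximal m = ∀ {x} → m ≤ x → x ≤ m

-- The empty chain is included, so P is inhabited as soon as every chain
-- has an upper bound.
ZornsLemma : ∀ a ℓ₁ ℓ₂ c → Set _
ZornsLemma a ℓ₁ ℓ₂ c =
  (P : Poset a ℓ₁ ℓ₂) →
  ((C : Pred (Poset.Carrier P) c) → IsChain P C → ∃ (IsUpperBound P C)) →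
  ∃ (IsMaximal P)

record ClassicalAxioms : Setω where
  field
    excludedMiddle : ∀ ℓ → ExcludedMiddle ℓ
    zornsLemma     : ∀ a ℓ₁ ℓ₂ c → ZornsLemma a ℓ₁ ℓ₂ c

------------------------------------------------------------------------
-- Raw partial algebras

-- A partial operation is represented by its graph:  x ⊕ y ⇓ z  says that
-- x ⊕ y is defined and equal to z.
record PartialMagma ℓ : Set (suc ℓ) where
  infix 4 _≈_ _⊕_⇓_ _⊖_⇓_ _≤_
  field
    Carrier : Set ℓ
    _≈_     : Rel Carrier ℓ
    _⊕_⇓_   : Carrier → Carrier → Carrier → Set ℓ

  Defined : Rel Carrier ℓ
  Defined x y = ∃[ z ] x ⊕ y ⇓ z

  _⊖_⇓_ : Carrier → Carrier → Carrier → Set ℓ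
  y ⊖ x ⇓ z = x ⊕ z ⇓ y

  _≤_ : Rel Carrier ℓ
  x ≤ y = ∃[ z ] y ⊖ x ⇓ z

  record IsMeet (x y m : Carrier) : Set ℓ where
    field
      lowerˡ   : m ≤ x
      lowerʳ   : m ≤ y
      greatest : ∀ {w} → w ≤ x → w ≤ y → w ≤ m

  RDP : Set ℓ
  RDP = ∀ {u v₁ v₂ v} → v₁ ⊕ v₂ ⇓ v → u ≤ v →
        ∃[ u₁ ] ∃[ u₂ ] (u₁ ≤ v₁ × u₂ ≤ v₂ × u₁ ⊕ u₂ ⇓ u)

-- In the restriction to Q, x ⊕ y is defined iff it is defined in A and
-- its value lies in Q.
_↾_ : ∀ {ℓ} (A : PartialMagma ℓ) → Pred (PartialMagma.Carrier A) ℓ →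
      PartialMagma ℓ
A ↾ Q = record
  { Carrier = Σ Carrier Q
  ; _≈_     = _≈_ on proj₁
  ; _⊕_⇓_   = λ x y z → proj₁ x ⊕ proj₁ y ⇓ proj₁ z
  }
  where open PartialMagma A

record RawGeneralizedEffectAlgebra ℓ : Set (suc ℓ) where
  field
    partialMagma : PartialMagma ℓ
  open PartialMagma partialMagma public
  field
    0# : Carrier

record RawEffectAlgebra ℓ : Set (suc ℓ) where
  field
    partialMagma : PartialMagma ℓ
  open PartialMagma partialMagma public
  field
    0# 1# : Carrier

------------------------------------------------------------------------
-- Morphisms

record IsEffectAlgebraMorphism {ℓ}
  (A B : RawEffectAlgebra ℓ)
  (f : RawEffectAlgebra.Carrier A → RawEffectAlgebra.Carrier B) : Set ℓ
  where
  private
    module A = RawEffectAlgebra A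
    module B = RawEffectAlgebra B
  field
    cong   : Congruent A._≈_ B._≈_ f
    1-homo : f A.1# B.≈ B.1#
    ⊕-homo : ∀ {x y z} → x A.⊕ y ⇓ z → f x B.⊕ f y ⇓ f z

record EffectAlgebraIsomorphism {ℓ} (A B : RawEffectAlgebra ℓ) : Set ℓ where
  private
    module A = RawEffectAlgebra A
    module B = RawEffectAlgebra B
  field
    to              : A.Carrier → B.Carrier
    from            : B.Carrier → A.Carrier
    to-isMorphism   : IsEffectAlgebraMorphism A B to
    from-isMorphism : IsEffectAlgebraMorphism B A from
    inverse         : Inverseᵇ A._≈_ B._≈_ to from

record GeneralizedEffectAlgebraIsomorphism {ℓ}
  (A B : RawGeneralizedEffectAlgebra ℓ) : Set ℓ where
  private
    module A = RawGeneralizedEffectAlgebra A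
    module B = RawGeneralizedEffectAlgebra B
  field
    to        : A.Carrier → B.Carrier
    cong      : Congruent A._≈_ B._≈_ to
    bijective : Bijective A._≈_ B._≈_ to
    0-homo    : to A.0# B.≈ B.0#
    ⊕-defined : ∀ x y → A.Defined x y ⇔ B.Defined (to x) (to y)
    ⊕-homo    : ∀ {x y z} → x A.⊕ y ⇓ z → to x B.⊕ to y ⇓ to z

------------------------------------------------------------------------
-- Effect algebras

record EffectAlgebra ℓ : Set (suc ℓ) where
  field
    rawEffectAlgebra : RawEffectAlgebra ℓ
  open RawEffectAlgebra rawEffectAlgebra public
  field
    isEquivalence : IsEquivalence _≈_
    ⊕-resp-≈      : ∀ {x x₁ y y₁ z z₁} → x ≈ x₁ → y ≈ y₁ → z ≈ z₁ →
                    x ⊕ y ⇓ z → x₁ ⊕ y₁ ⇓ z₁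
    ⊕-functional  : ∀ {x y z z₁} → x ⊕ y ⇓ z → x ⊕ y ⇓ z₁ → z ≈ z₁
    0≉1           : ¬ (0# ≈ 1#)
    ⊕-comm        : ∀ {x y z} → x ⊕ y ⇓ z → y ⊕ x ⇓ z
    ⊕-assocʳ      : ∀ {x y z xy w} → x ⊕ y ⇓ xy → xy ⊕ z ⇓ w →
                    ∃[ yz ] (y ⊕ z ⇓ yz × x ⊕ yz ⇓ w)
    ⊕-assocˡ      : ∀ {x y z yz w} → y ⊕ z ⇓ yz → x ⊕ yz ⇓ w →
                    ∃[ xy ] (x ⊕ y ⇓ xy × xy ⊕ z ⇓ w)
    orthosupplement : ∀ x → ∃! _≈_ (λ y → x ⊕ y ⇓ 1#)
    1⊕-defined⇒0  : ∀ {x} → Defined 1# x → x ≈ 0#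

  open IsEquivalence isEquivalence public using (refl; sym; trans)

  infix 8 _′
  _′ : Carrier → Carrier
  x ′ = proj₁ (orthosupplement x)

  Sharp : Pred Carrier ℓ
  Sharp x = IsMeet x (x ′) 0#

  Meager : Pred Carrier ℓ
  Meager x = ∀ {v} → v ∈ Sharp → v ≤ x → v ≈ 0#

  Homogeneous : Set ℓ
  Homogeneous = ∀ {u v₁ v₂ v} → v₁ ⊕ v₂ ⇓ v → u ≤ v → v ≤ u ′ →
                ∃[ u₁ ] ∃[ u₂ ] (u₁ ≤ v₁ × u₂ ≤ v₂ × u₁ ⊕ u₂ ⇓ u)

  record IsSubEffectAlgebra (Q : Pred Carrier ℓ) : Set ℓ where
    field
      resp-≈    : Q Respects _≈_
      1∈        : 1# ∈ Q
      two⇒three : ∀ {x y z} → x ⊕ y ⇓ z →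
                  (x ∈ Q × y ∈ Q) ⊎ (x ∈ Q × z ∈ Q) ⊎ (y ∈ Q × z ∈ Q) →
                  x ∈ Q × y ∈ Q × z ∈ Q

  record IsBlock (B : Pred Carrier ℓ) : Set (suc ℓ) where
    field
      isSubEffectAlgebra : IsSubEffectAlgebra B
      rdp                : PartialMagma.RDP (partialMagma ↾ B)
      maximal            : ∀ {C} → IsSubEffectAlgebra C →
                           PartialMagma.RDP (partialMagma ↾ C) →
                           B ⊆ C → C ⊆ B

  record IsSmallestSharpAbove (x s : Carrier) : Set ℓ where
    field
      sharp : s ∈ Sharp
      above : x ≤ s
      least : ∀ {t} → t ∈ Sharp → x ≤ t → s ≤ t

  record IsLargestSharpBelow (x s : Carrier) : Set ℓ where
    field
      sharp    : s ∈ Sharp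
      below    : s ≤ x
      greatest : ∀ {t} → t ∈ Sharp → t ≤ x → t ≤ s

  SharplyDominating : Set ℓ
  SharplyDominating = ∀ x → ∃ (IsSmallestSharpAbove x)

  ′-⊕ : ∀ x → x ⊕ x ′ ⇓ 1#
  ′-⊕ x = proj₁ (proj₂ (orthosupplement x))

  ′-unique : ∀ {x y} → x ⊕ y ⇓ 1# → x ′ ≈ y
  ′-unique {x} = proj₂ (proj₂ (orthosupplement x))

  ′-involutive : ∀ x → x ′ ′ ≈ x
  ′-involutive x = ′-unique (⊕-comm (′-⊕ x))

  1⊕0 : 1# ⊕ 0# ⇓ 1#
  1⊕0 = ⊕-resp-≈ refl (1⊕-defined⇒0 (1# , ′-⊕ 1#)) refl (′-⊕ 1#)

  ⊕-identityʳ : ∀ x → x ⊕ 0# ⇓ x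
  ⊕-identityʳ x with ⊕-assocʳ (⊕-comm (′-⊕ x)) 1⊕0
  ... | y , x⊕0⇓y , x′⊕y⇓1 =
    ⊕-resp-≈ refl refl
      (trans (sym (′-unique x′⊕y⇓1)) (′-involutive x)) x⊕0⇓y

  0-minimum : ∀ x → 0# ≤ x
  0-minimum x = x , ⊕-comm (⊕-identityʳ x)

  ≤0⇒≈0 : ∀ {x} → x ≤ 0# → x ≈ 0#
  ≤0⇒≈0 (y , x⊕y⇓0) with ⊕-assocˡ x⊕y⇓0 1⊕0
  ... | w , 1⊕x⇓w , _ = 1⊕-defined⇒0 (w , 1⊕x⇓w)

  ≤-resp-≈ : ∀ {x x₁ y y₁} → x ≈ x₁ → y ≈ y₁ → x ≤ y → x₁ ≤ y₁
  ≤-resp-≈ x≈ y≈ (z , p) = z , ⊕-resp-≈ x≈ refl y≈ p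

  ′-antitone : ∀ {x y} → x ≤ y → y ′ ≤ x ′
  ′-antitone {x} {y} (z , x⊕z⇓y) with ⊕-assocʳ x⊕z⇓y (′-⊕ y)
  ... | b , z⊕y′⇓b , x⊕b⇓1 =
    z , ⊕-resp-≈ refl refl (sym (′-unique x⊕b⇓1)) (⊕-comm z⊕y′⇓b)

  Sharp-′ : ∀ {x} → x ∈ Sharp → x ′ ∈ Sharp
  Sharp-′ {x} s = record
    { lowerˡ   = lowerʳ
    ; lowerʳ   = 0-minimum _
    ; greatest = λ p q → greatest (≤-resp-≈ refl (′-involutive x) q) p
    }
    where open IsMeet s

  1-sharp : 1# ∈ Sharp
  1-sharp = record
    { lowerˡ   = 0-minimum _
    ; lowerʳ   = 0-minimum _
    ; greatest = λ _ → ≤-resp-≈ refl (′-unique 1⊕0)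
    }

  0-sharp : 0# ∈ Sharp
  0-sharp = record
    { lowerˡ   = 0-minimum _
    ; lowerʳ   = 0-minimum _
    ; greatest = λ p _ → p
    }

  0-meager : 0# ∈ Meager
  0-meager _ = ≤0⇒≈0

  largestSharpBelow : SharplyDominating → ∀ x → ∃ (IsLargestSharpBelow x)
  largestSharpBelow sd x = proj₁ (sd (x ′)) ′ , record
    { sharp    = Sharp-′ sharp
    ; below    = ≤-resp-≈ refl (′-involutive x) (′-antitone above)
    ; greatest = λ {t} t∈S t≤x →
        ≤-resp-≈ (′-involutive t) refl
          (′-antitone (least (Sharp-′ t∈S) (′-antitone t≤x)))
    }
    where open IsSmallestSharpAbove (proj₂ (sd (x ′)))

  S : RawEffectAlgebra ℓ
  S = record
    { partialMagma = partialMagma ↾ Sharp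
    ; 0#           = 0# , 0-sharp
    ; 1#           = 1# , 1-sharp
    }

  M : RawGeneralizedEffectAlgebra ℓ
  M = record
    { partialMagma = partialMagma ↾ Meager
    ; 0#           = 0# , 0-meager
    }

  module S = RawEffectAlgebra S
  module M = RawGeneralizedEffectAlgebra M

  h : S.Carrier → Pred M.Carrier ℓ
  h s x = proj₁ x ≤ proj₁ s

------------------------------------------------------------------------
-- TRT-effect algebras

module SharplyDominatingEffectAlgebra {ℓ} (E : EffectAlgebra ℓ)
  (sharplyDominating : EffectAlgebra.SharplyDominating E) where

  open EffectAlgebra E

  ⌈_⌉ : Carrier → S.Carrier
  ⌈ x ⌉ = proj₁ (sharplyDominating x) ,
          IsSmallestSharpAbove.sharp (proj₂ (sharplyDominating x))

  ⌊_⌋ : Carrier → S.Carrier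
  ⌊ x ⌋ = proj₁ (largestSharpBelow sharplyDominating x) ,
          IsLargestSharpBelow.sharp
            (proj₂ (largestSharpBelow sharplyDominating x))

  -- Conditions (i)-(iii) on y.  The first field makes sense of ⊖ in M for
  -- y in the remaining ones.
  record TRTConditions (x : M.Carrier) (y : Carrier) : Set ℓ where
    x̂ : S.Carrier
    x̂ = ⌈ proj₁ x ⌉
    field
      y∈M : y ∈ Meager
      ŷ≈x̂ : ⌈ y ⌉ S.≈ x̂
    yₘ : M.Carrier
    yₘ = y , y∈M
    field
      x⊕[y⊖x∧y]∈h :
        ∃[ m ] ∃[ d ] ∃[ w ]
          (IsMeet (proj₁ x) y (proj₁ m) × yₘ M.⊖ m ⇓ d ×
           x M.⊕ d ⇓ w × w ∈ h x̂)
      z⊕x∈h :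
        ∀ z → z ∈ h x̂ →
          (∃[ w ] (z M.⊕ x ⇓ w × w ∈ h x̂)) ⇔
          (proj₁ z ≤ y × ∃[ d ] (yₘ M.⊖ z ⇓ d × ⌈ proj₁ d ⌉ S.≈ x̂))

record TRTEffectAlgebra ℓ : Set (suc ℓ) where
  field
    effectAlgebra : EffectAlgebra ℓ
  open EffectAlgebra effectAlgebra public
  field
    homogeneous       : Homogeneous
    sharplyDominating : SharplyDominating
  open SharplyDominatingEffectAlgebra effectAlgebra sharplyDominating public
  field
    block-interval : ∀ {B} → IsBlock B → ∀ {x} → x ∈ B →
                     ∀ {z} → proj₁ ⌊ x ⌋ ≤ z → z ≤ x → z ∈ B
    -- x̂ ⊖ x satisfies the conditions (⇐), and nothing else does (⇒).
    trt : ∀ x y → TRTConditions x y ⇔ proj₁ ⌈ proj₁ x ⌉ ⊖ proj₁ x ⇓ y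

------------------------------------------------------------------------
-- Isomorphisms of algebras and of triples

infix 4 _≅_
_≅_ : ∀ {ℓ} → TRTEffectAlgebra ℓ → TRTEffectAlgebra ℓ → Set ℓ
E ≅ F = EffectAlgebraIsomorphism
  (TRTEffectAlgebra.rawEffectAlgebra E)
  (TRTEffectAlgebra.rawEffectAlgebra F)

image : ∀ {ℓ} {A B : Set ℓ} → Rel B ℓ → (A → B) → Pred A ℓ → Pred B ℓ
image _≈_ f P y = ∃[ x ] (x ∈ P × f x ≈ y)

record TripleIsomorphism {ℓ} (E F : TRTEffectAlgebra ℓ) : Set ℓ where
  private
    module E = TRTEffectAlgebra E
    module F = TRTEffectAlgebra F
  field
    σ : EffectAlgebraIsomorphism E.S F.S
    μ : GeneralizedEffectAlgebraIsomorphism E.M F.M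
  private
    module σ = EffectAlgebraIsomorphism σ
    module μ = GeneralizedEffectAlgebraIsomorphism μ
  field
    h-compatible : ∀ s → image F.M._≈_ μ.to (E.h s) ≐ F.h (σ.to s)

{-# OPTIONS --safe #-}

-- In E every x is uniquely s ⊕ m with s sharp and m meager, so a triple
-- isomorphism (σ, μ) suggests the map x ↦ σ s ⊕ μ m; the point is that it
-- preserves sums of meager elements.  If m ⊕ n = r ⊕ q with r sharp and q
-- meager, then a block containing m and n contains r, and the RDP gives
-- m = m₁ ⊕ m₂ and n = n₁ ⊕ n₂ with m₁ ⊕ n₁ = r and m₂ ⊕ n₂ = q.  The second
-- sum lives in M(E), and in the first n₁ = m̂₁ ⊖ m₁ is determined by the triple.
--
-- Blocks through orthogonal m and n come from the partition of 1 into m, n and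
-- (m ⊕ n)′: refine it repeatedly by splittings p = v ⊕ w with p ≤ v′.  By
-- homogeneity such refinements have common refinements, their partial sums form
-- a sub-effect algebra with the RDP, and Zorn's lemma enlarges it to a block.

module Submission where

open import Defs
open import Function.Bundles using (_⇔_; mk⇔; Equivalence)
open import Level using (Lift; lift; suc)
open import Axiom.ExcludedMiddle using (ExcludedMiddle)
open import Data.Bool.Base using (Bool; true; false; not; _∧_; _∨_)
open import Data.Empty using (⊥)
open import Data.Product using (∃; ∃₂; _×_; _,_; proj₁; proj₂)
open import Data.Sum using (_⊎_; inj₁; inj₂)
open import Data.Unit.Base using (⊤; tt)
open import Function.Base using (_∘_; id; const)
open import Relation.Binary.Bundles using (Poset)
open import Relation.Binary.PropositionalEquality
  using (_≡_; cong) renaming (refl to refl′)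
open import Relation.Binary.Structures using (IsEquivalence)
open import Relation.Nullary using (yes; no; contradiction)
open import Relation.Unary using (Pred; _∈_; _⊆_; _≐_)

-- Cancellation, order and sharp elements

module EffectAlgebraProperties {ℓ} (E : EffectAlgebra ℓ) where
  open EffectAlgebra E

  private variable
    a b c d p q v x y z x₁ y₁ z₁ : Carrier

  respˡ : x ≈ x₁ → x ⊕ y ⇓ z → x₁ ⊕ y ⇓ z
  respˡ e = ⊕-resp-≈ e refl refl

  respʳ : y ≈ y₁ → x ⊕ y ⇓ z → x ⊕ y₁ ⇓ z
  respʳ e = ⊕-resp-≈ refl e refl

  respᵒ : z ≈ z₁ → x ⊕ y ⇓ z → x ⊕ y ⇓ z₁
  respᵒ e = ⊕-resp-≈ refl refl e

  ⊕-cong : x ≈ x₁ → y ≈ y₁ → x ⊕ y ⇓ z → x₁ ⊕ y₁ ⇓ z₁ → z ≈ z₁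
  ⊕-cong e f g = ⊕-functional (⊕-resp-≈ e f refl g)

  ⊕-identityˡ : ∀ x → 0# ⊕ x ⇓ x
  ⊕-identityˡ x = ⊕-comm (⊕-identityʳ x)

  -- Both `y` and `y₁` are the orthosupplement of `x ⊕ z ′`.
  ⊕-cancelˡ : x ⊕ y ⇓ z → x ⊕ y₁ ⇓ z → y ≈ y₁
  ⊕-cancelˡ e e₁ with ⊕-assocʳ (⊕-comm e) (′-⊕ _) | ⊕-assocʳ (⊕-comm e₁) (′-⊕ _)
  ... | _ , f , g | _ , f₁ , g₁ =
    trans (sym (′-unique (⊕-comm g)))
      (′-unique (respˡ (⊕-functional f₁ f) (⊕-comm g₁)))

  interchange : a ⊕ b ⇓ p → c ⊕ d ⇓ q → p ⊕ q ⇓ z →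
                ∃₂ λ x y → a ⊕ c ⇓ x × b ⊕ d ⇓ y × x ⊕ y ⇓ z
  interchange ab cd pq with ⊕-assocʳ ab pq
  ... | _ , b⊕q , a⊕bq with ⊕-assocˡ cd b⊕q
  ... | _ , b⊕c , bc⊕d with ⊕-assocʳ (⊕-comm b⊕c) bc⊕d
  ... | _ , b⊕d , c⊕bd with ⊕-assocˡ c⊕bd a⊕bq
  ... | _ , a⊕c , ac⊕bd = _ , _ , a⊕c , b⊕d , ac⊕bd

  ⊕-interchange : a ⊕ b ⇓ p → c ⊕ d ⇓ q → p ⊕ q ⇓ z →
                  a ⊕ c ⇓ x → b ⊕ d ⇓ y → x ⊕ y ⇓ z
  ⊕-interchange ab cd pq ac bd with interchange ab cd pq
  ... | _ , _ , ac′ , bd′ , e =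
    ⊕-resp-≈ (⊕-functional ac′ ac) (⊕-functional bd′ bd) refl e

  ⇓⇒≤ˡ : x ⊕ y ⇓ z → x ≤ z
  ⇓⇒≤ˡ e = _ , e

  ⇓⇒≤ʳ : x ⊕ y ⇓ z → y ≤ z
  ⇓⇒≤ʳ e = _ , ⊕-comm e

  ≤-refl : x ≤ x
  ≤-refl = _ , ⊕-identityʳ _

  ≤-reflexive : x ≈ y → x ≤ y
  ≤-reflexive e = ≤-resp-≈ refl e ≤-refl

  ≤-trans : x ≤ y → y ≤ z → x ≤ z
  ≤-trans (_ , e) (_ , f) with ⊕-assocʳ e f
  ... | _ , _ , g = _ , g

  ≤-antisym : x ≤ y → y ≤ x → x ≈ y
  ≤-antisym (_ , e) (_ , f) with ⊕-assocʳ e f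
  ... | _ , ab , g =
    ⊕-functional (⊕-identityʳ _)
      (respʳ (≤0⇒≈0 (_ , respᵒ (⊕-cancelˡ g (⊕-identityʳ _)) ab)) e)

  ⊕-mono-≤ : p ⊕ q ⇓ z → x ≤ p → y ≤ q → ∃ λ w → x ⊕ y ⇓ w × w ≤ z
  ⊕-mono-≤ e (_ , f) (_ , g) with interchange f g e
  ... | _ , _ , xy , _ , h = _ , xy , _ , h

  ⊕-cancelˡ-≤ : a ⊕ x ⇓ p → a ⊕ y ⇓ q → p ≤ q → x ≤ y
  ⊕-cancelˡ-≤ e f (_ , g) with ⊕-assocʳ e g
  ... | _ , xr , h = _ , respᵒ (⊕-cancelˡ h f) xr

  ≤′⇒defined : x ≤ y ′ → Defined x y
  ≤′⇒defined (_ , e) with ⊕-assocˡ e (′-⊕ _)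
  ... | _ , f , _ = _ , ⊕-comm f

  defined⇒≤′ : x ⊕ y ⇓ z → x ≤ y ′
  defined⇒≤′ e with ⊕-assocʳ (⊕-comm e) (′-⊕ _)
  ... | _ , f , g = _ , respᵒ (sym (′-unique g)) f

  -- Passes the side condition `p ≤ v ′` of homogeneous splittings on to smaller elements.
  ≤′-mono : x ≤ p → p ≤ v ′ → a ≤ v → x ≤ a ′
  ≤′-mono x≤p p≤v′ a≤v = ≤-trans x≤p (≤-trans p≤v′ (′-antitone a≤v))

  Meager-≤ : x ≤ y → y ∈ Meager → x ∈ Meager
  Meager-≤ x≤y m s v≤x = m s (≤-trans v≤x x≤y)

  Sharp-intro : (∀ {w} → w ≤ x → w ≤ x ′ → w ≈ 0#) → x ∈ Sharp
  Sharp-intro f = record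
    { lowerˡ   = 0-minimum _
    ; lowerʳ   = 0-minimum _
    ; greatest = λ p q → ≤-reflexive (f p q)
    }

  Sharp-resp-≈ : x ≈ y → x ∈ Sharp → y ∈ Sharp
  Sharp-resp-≈ e s = Sharp-intro λ p q → ≤0⇒≈0
    (IsMeet.greatest s (≤-trans p (≤-reflexive (sym e)))
      (≤-trans q (′-antitone (≤-reflexive e))))

  module _ (homogeneous : Homogeneous) where

    -- A common lower bound `w` of `z` and `z ′` satisfies `w ≤ x ⊕ y ≤ w ′`, so homogeneity splits
    -- it along `x` and `y`. Each part lies below a sharp element and its orthosupplement, hence is
    -- zero.
    Sharp-⊕ : x ∈ Sharp → y ∈ Sharp → x ⊕ y ⇓ z → z ∈ Sharp
    Sharp-⊕ {x} {y} {z} sx sy e = Sharp-intro below-both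
      where
      below-both : ∀ {w} → w ≤ z → w ≤ z ′ → w ≈ 0#
      below-both w≤z w≤z′
        with homogeneous e w≤z
               (≤-resp-≈ (′-involutive z) refl (′-antitone w≤z′))
      ... | u₁ , u₂ , u₁≤x , u₂≤y , f = ⊕-functional f
        (⊕-resp-≈ (sym (null sx u₁≤x (⇓⇒≤ˡ f) (⇓⇒≤ˡ e)))
                  (sym (null sy u₂≤y (⇓⇒≤ʳ f) (⇓⇒≤ʳ e))) refl
                  (⊕-identityʳ 0#))
        where
        null : ∀ {s u} → s ∈ Sharp → u ≤ s → u ≤ _ → s ≤ z → u ≈ 0#
        null s u≤s u≤w s≤z = ≤0⇒≈0 (IsMeet.greatest s u≤s
          (≤-trans u≤w (≤-trans w≤z′ (′-antitone s≤z))))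

    -- `y` is the orthosupplement of `x ⊕ z ′`, a sum of sharp elements.
    Sharp-⊖ : x ∈ Sharp → z ∈ Sharp → x ⊕ y ⇓ z → y ∈ Sharp
    Sharp-⊖ sx sz e with ⊕-assocʳ (⊕-comm e) (′-⊕ _)
    ... | _ , f , g = Sharp-resp-≈ (′-unique (⊕-comm g))
      (Sharp-′ (Sharp-⊕ sx (Sharp-′ sz) f))

-- Homogeneous splittings and blocks

-- Addition in the two-element effect algebra. Pointwise, the third set of labels is the disjoint
-- union of the first two.
data Split : Bool → Bool → Bool → Set where
  inˡ  : Split true false true
  inʳ  : Split false true true
  none : Split false false false

split-∧ : ∀ i j → Split (i ∧ j) (i ∧ not j) i
split-∧ true  true  = inˡ
split-∧ true  false = inʳ
split-∧ false _     = none

module HomogeneousBlocks {ℓ} (E : EffectAlgebra ℓ)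
  (homogeneous : EffectAlgebra.Homogeneous E) where

  open EffectAlgebra E
  open EffectAlgebraProperties E

  private variable
    A B : Set
    o p v w x y z : Carrier

  -- The fixed first partition. Its splittings may be arbitrary, since all trees over one base share
  -- them and only what lies below has to be refined jointly.
  data Base : Carrier → Set ℓ where
    atom  : ∀ p → Base p
    split : v ⊕ w ⇓ p → Base v → Base w → Base p

  -- A further decomposition of the pieces of a base, with labelled parts.
  -- Below the base only homogeneous splittings p = v ⊕ w, p ≤ v′, are
  -- allowed: by homogeneity these, unlike general ones, have common
  -- refinements.
  data Tree (A : Set) : Base p → Set ℓ where
    leaf : A → Tree A (atom p)
    node : v ⊕ w ⇓ p → p ≤ v ′ →
           Tree A (atom v) → Tree A (atom w) → Tree A (atom p)
    base : ∀ {b : Base v} {c : Base w} {e : v ⊕ w ⇓ p} →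
           Tree A b → Tree A c → Tree A (split e b c)

  private variable
    b : Base p

  select : Bool → Carrier → Carrier
  select true  p = p
  select false p = 0#

  select-≤ : ∀ i p → select i p ≤ p
  select-≤ true  p = ≤-refl
  select-≤ false p = 0-minimum p

  select-⊕ : ∀ i → v ⊕ w ⇓ p → select i v ⊕ select i w ⇓ select i p
  select-⊕ true  e = e
  select-⊕ false e = ⊕-identityʳ 0#

  -- The sum of the parts whose label satisfies φ.  Abstract, as comparing its
  -- unfoldings makes type checking infeasible.
  abstract
    mutual
      meas : Tree A {p} b → (A → Bool) → Carrier
      meas {p = p} (leaf a)   φ = select (φ a) p
      meas (node e _ s t)     φ = proj₁ (⊕-mono-≤ e (meas-≤ s φ) (meas-≤ t φ))
      meas (base {e = e} s t) φ = proj₁ (⊕-mono-≤ e (meas-≤ s φ) (meas-≤ t φ))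

      -- Proved together with `meas`: the partial sums over two subtrees are orthogonal because they
      -- lie below orthogonal elements.
      meas-≤ : (t : Tree A {p} b) (φ : A → Bool) → meas t φ ≤ p
      meas-≤ (leaf a)           φ = select-≤ (φ a) _
      meas-≤ (node e _ s t)     φ =
        proj₂ (proj₂ (⊕-mono-≤ e (meas-≤ s φ) (meas-≤ t φ)))
      meas-≤ (base {e = e} s t) φ =
        proj₂ (proj₂ (⊕-mono-≤ e (meas-≤ s φ) (meas-≤ t φ)))

    meas-leaf : ∀ (a : A) φ → meas (leaf {p = p} a) φ ≈ select (φ a) p
    meas-leaf a φ = refl

    meas-node : ∀ (e : v ⊕ w ⇓ p) (c : p ≤ v ′) (s : Tree A (atom v))
                (t : Tree A (atom w)) φ →
                meas s φ ⊕ meas t φ ⇓ meas (node e c s t) φ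
    meas-node e _ s t φ =
      proj₁ (proj₂ (⊕-mono-≤ e (meas-≤ s φ) (meas-≤ t φ)))

    meas-base : ∀ {b : Base v} {c : Base w} (e : v ⊕ w ⇓ p)
                (s : Tree A b) (t : Tree A c) φ →
                meas s φ ⊕ meas t φ ⇓ meas (base {e = e} s t) φ
    meas-base e s t φ =
      proj₁ (proj₂ (⊕-mono-≤ e (meas-≤ s φ) (meas-≤ t φ)))

  -- Finite additivity over disjoint sets of labels; at an inner node the partial sums regroup.
  meas-⊕ : (t : Tree A {p} b) (φ ψ χ : A → Bool) →
           (∀ a → Split (φ a) (ψ a) (χ a)) →
           meas t φ ⊕ meas t ψ ⇓ meas t χ
  meas-⊕ (leaf {p} a) φ ψ χ σ = ⊕-resp-≈ (sym (meas-leaf a φ))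
    (sym (meas-leaf a ψ)) (sym (meas-leaf a χ)) (go (σ a))
    where
    go : ∀ {i j k} → Split i j k → select i p ⊕ select j p ⇓ select k p
    go inˡ  = ⊕-identityʳ p
    go inʳ  = ⊕-identityˡ p
    go none = ⊕-identityʳ 0#
  meas-⊕ (node e c s t) φ ψ χ σ =
    ⊕-interchange (meas-⊕ s φ ψ χ σ) (meas-⊕ t φ ψ χ σ)
      (meas-node e c s t χ) (meas-node e c s t φ) (meas-node e c s t ψ)
  meas-⊕ (base {e = e} s t) φ ψ χ σ =
    ⊕-interchange (meas-⊕ s φ ψ χ σ) (meas-⊕ t φ ψ χ σ)
      (meas-base e s t χ) (meas-base e s t φ) (meas-base e s t ψ)

  fill : A → (b : Base p) → Tree A b
  fill a (atom p)      = leaf a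
  fill a (split e b c) = base (fill a b) (fill a c)

  relabel : (A → B) → Tree A b → Tree B b
  relabel f (leaf a)       = leaf (f a)
  relabel f (node e c s t) = node e c (relabel f s) (relabel f t)
  relabel f (base s t)     = base (relabel f s) (relabel f t)

  meas-full : (t : Tree A {p} b) → meas t (const true) ≈ p
  meas-full (leaf a) = meas-leaf a _
  meas-full (node e c s t) =
    ⊕-cong (meas-full s) (meas-full t) (meas-node e c s t _) e
  meas-full (base {e = e} s t) =
    ⊕-cong (meas-full s) (meas-full t) (meas-base e s t _) e

  meas-cong : (t : Tree A b) {φ ψ : A → Bool} → (∀ a → φ a ≡ ψ a) →
              meas t φ ≈ meas t ψ
  meas-cong (leaf {p} a) {φ} {ψ} h = trans (meas-leaf a φ)
    (trans (≡⇒≈ (cong (λ i → select i p) (h a))) (sym (meas-leaf a ψ)))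
    where open IsEquivalence isEquivalence using () renaming (reflexive to ≡⇒≈)
  meas-cong (node e c s t) h =
    ⊕-cong (meas-cong s h) (meas-cong t h)
      (meas-node e c s t _) (meas-node e c s t _)
  meas-cong (base {e = e} s t) h =
    ⊕-cong (meas-cong s h) (meas-cong t h)
      (meas-base e s t _) (meas-base e s t _)

  meas-relabel : (f : A → B) (t : Tree A b) (φ : B → Bool) →
                 meas (relabel f t) φ ≈ meas t (φ ∘ f)
  meas-relabel f (leaf a) φ = trans (meas-leaf (f a) φ) (sym (meas-leaf a (φ ∘ f)))
  meas-relabel f (node e c s t) φ =
    ⊕-cong (meas-relabel f s φ) (meas-relabel f t φ)
      (meas-node e c (relabel f s) (relabel f t) φ) (meas-node e c s t _)
  meas-relabel f (base {e = e} s t) φ =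
    ⊕-cong (meas-relabel f s φ) (meas-relabel f t φ)
      (meas-base e (relabel f s) (relabel f t) φ) (meas-base e s t _)

  -- The diamond property: two homogeneous splittings of p refine each other by
  -- homogeneous splittings.
  restrict : (t : Tree A (atom p)) → v ⊕ w ⇓ p → p ≤ v ′ →
             ∃₂ λ (s : Tree A (atom v)) (u : Tree A (atom w)) →
             ∀ φ → meas s φ ⊕ meas u φ ⇓ meas t φ
  restrict (leaf a) e _ = leaf a , leaf a , λ φ → ⊕-resp-≈ (sym (meas-leaf a φ))
    (sym (meas-leaf a φ)) (sym (meas-leaf a φ)) (select-⊕ (φ a) e)
  -- Homogeneity gives `v = a ⊕ b`, with remainders `a₁` and `b₁` in the two halves of `p`. These
  -- four pieces refine both splittings, since `a₁ ⊕ b₁ = w` by cancelling `v`.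
  restrict (node e₁ c₁ t₁ t₂) e c with homogeneous e₁ (⇓⇒≤ˡ e) c
  ... | a , b , (a₁ , aa₁) , (b₁ , bb₁) , ab with interchange aa₁ bb₁ e₁
  ... | _ , _ , ab′ , a₁b₁′ , f
    with ⊕-resp-≈ refl refl
           (⊕-cancelˡ (respˡ (⊕-functional ab′ ab) f) e) a₁b₁′
  ... | a₁b₁
    with restrict t₁ aa₁ (≤′-mono (⇓⇒≤ˡ e₁) c (⇓⇒≤ˡ ab))
       | restrict t₂ bb₁ (≤′-mono (⇓⇒≤ʳ e₁) c (⇓⇒≤ʳ ab))
  ... | sa , sa₁ , r₁ | sb , sb₁ , r₂ =
    node ab ca sa sb , node a₁b₁ ca₁ sa₁ sb₁ ,
    λ φ → ⊕-interchange (r₁ φ) (r₂ φ) (meas-node e₁ c₁ t₁ t₂ φ)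
            (meas-node ab ca sa sb φ) (meas-node a₁b₁ ca₁ sa₁ sb₁ φ)
    where
    -- The new splitting of `v` is homogeneous because of `c`, that of `w` because of `c₁`.
    ca  = ≤′-mono (⇓⇒≤ˡ e) c (⇓⇒≤ˡ ab)
    ca₁ = ≤′-mono (⇓⇒≤ʳ e) c₁ (⇓⇒≤ʳ aa₁)

  -- Common refinement, by induction on `s`: `restrict` carries `t` across each homogeneous
  -- splitting, and the splittings of the base are shared by both trees.
  join : (s : Tree A b) (t : Tree B b) →
         ∃ λ (r : Tree (A × B) b) →
         (∀ φ → meas r (φ ∘ proj₁) ≈ meas s φ) ×
         (∀ ψ → meas r (ψ ∘ proj₂) ≈ meas t ψ)
  join (leaf a) t =
    relabel (a ,_) t ,
    (λ φ → trans (meas-relabel (a ,_) t (φ ∘ proj₁))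
      (trans (meas-const t (φ a)) (sym (meas-leaf a φ)))) ,
    (λ ψ → meas-relabel (a ,_) t (ψ ∘ proj₂))
    where
    meas-const : (t : Tree B {p} b) → ∀ i → meas t (const i) ≈ select i p
    meas-const t true  = meas-full t
    meas-const t false =
      ⊕-cancelˡ (meas-⊕ t (const true) (const false) (const true) λ _ → inˡ)
        (⊕-identityʳ _)
  join (node e c s₁ s₂) t with restrict t e c
  ... | t₁ , t₂ , r with join s₁ t₁ | join s₂ t₂
  ... | u₁ , f₁ , g₁ | u₂ , f₂ , g₂ =
    node e c u₁ u₂ ,
    (λ φ → ⊕-cong (f₁ φ) (f₂ φ)
      (meas-node e c u₁ u₂ _) (meas-node e c s₁ s₂ φ)) ,
    (λ ψ → ⊕-cong (g₁ ψ) (g₂ ψ)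
      (meas-node e c u₁ u₂ _) (r ψ))
  join (base {e = e} s₁ s₂) (base t₁ t₂) with join s₁ t₁ | join s₂ t₂
  ... | u₁ , f₁ , g₁ | u₂ , f₂ , g₂ =
    base u₁ u₂ ,
    (λ φ → ⊕-cong (f₁ φ) (f₂ φ)
      (meas-base e u₁ u₂ _) (meas-base e s₁ s₂ φ)) ,
    (λ ψ → ⊕-cong (g₁ ψ) (g₂ ψ)
      (meas-base e u₁ u₂ _) (meas-base e t₁ t₂ ψ))

  -- Makes `o` a partial sum in a refinement of `t`, the new label marking its pieces. Homogeneity
  -- distributes `o` over the subtrees; at a leaf the hypotheses make it one half of a homogeneous
  -- splitting.
  carve : (t : Tree A b) (ψ : A → Bool) → o ≤ meas t ψ → meas t ψ ≤ o ′ →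
          ∃ λ (r : Tree (A × Bool) b) →
          (∀ φ → meas r (φ ∘ proj₁) ≈ meas t φ) ×
          meas r (λ (a , i) → ψ a ∧ i) ≈ o
  carve {o = o} (leaf {p = p} a) ψ o≤ ≤o′ = go (ψ a) refl′
    (≤-resp-≈ refl (meas-leaf a ψ) o≤) (≤-resp-≈ (meas-leaf a ψ) refl ≤o′)
    where
    only : _ × Bool → Bool
    only (a , i) = ψ a ∧ i
    go : ∀ i → ψ a ≡ i → o ≤ select i p → select i p ≤ o ′ →
         ∃ λ (r : Tree (_ × Bool) (atom p)) →
         (∀ φ → meas r (φ ∘ proj₁) ≈ meas (leaf {p = p} a) φ) ×
         meas r only ≈ o
    go true ψa (d , e) c =
      node e c inside outside ,
      (λ φ → ⊕-cong (meas-leaf _ (φ ∘ proj₁)) (meas-leaf _ (φ ∘ proj₁))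
        (meas-node e c inside outside (φ ∘ proj₁))
        (respᵒ (sym (meas-leaf a φ)) (select-⊕ (φ a) e))) ,
      ⊕-cong (meas-leaf _ only) (meas-leaf _ only)
        (meas-node e c inside outside only) (only-inside ψa)
      where
      inside : Tree _ (atom o)
      inside  = leaf (a , true)
      outside : Tree _ (atom d)
      outside = leaf (a , false)
      only-inside : ∀ {i d} → i ≡ true →
                    select (i ∧ true) o ⊕ select (i ∧ false) d ⇓ o
      only-inside refl′ = ⊕-identityʳ o
    go false ψa o≤0 _ =
      leaf (a , false) ,
      (λ φ → trans (meas-leaf _ (φ ∘ proj₁)) (sym (meas-leaf a φ))) ,
      trans (meas-leaf _ only) (empty ψa)
      where
      empty : ∀ {i} → i ≡ false → select (i ∧ false) p ≈ o
      empty refl′ = sym (≤0⇒≈0 o≤0)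
  carve (node e c s t) ψ o≤ ≤o′ with homogeneous (meas-node e c s t ψ) o≤ ≤o′
  ... | _ , _ , o₁≤ , o₂≤ , f
    with carve s ψ o₁≤ (≤′-mono (⇓⇒≤ˡ (meas-node e c s t ψ)) ≤o′ (⇓⇒≤ˡ f))
       | carve t ψ o₂≤ (≤′-mono (⇓⇒≤ʳ (meas-node e c s t ψ)) ≤o′ (⇓⇒≤ʳ f))
  ... | r₁ , f₁ , g₁ | r₂ , f₂ , g₂ =
    node e c r₁ r₂ ,
    (λ φ → ⊕-cong (f₁ φ) (f₂ φ)
      (meas-node e c r₁ r₂ _) (meas-node e c s t φ)) ,
    ⊕-cong g₁ g₂ (meas-node e c r₁ r₂ _) f
  carve (base {e = e} s t) ψ o≤ ≤o′
    with homogeneous (meas-base e s t ψ) o≤ ≤o′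
  ... | _ , _ , o₁≤ , o₂≤ , f
    with carve s ψ o₁≤ (≤′-mono (⇓⇒≤ˡ (meas-base e s t ψ)) ≤o′ (⇓⇒≤ˡ f))
       | carve t ψ o₂≤ (≤′-mono (⇓⇒≤ʳ (meas-base e s t ψ)) ≤o′ (⇓⇒≤ʳ f))
  ... | r₁ , f₁ , g₁ | r₂ , f₂ , g₂ =
    base r₁ r₂ ,
    (λ φ → ⊕-cong (f₁ φ) (f₂ φ)
      (meas-base e r₁ r₂ _) (meas-base e s t φ)) ,
    ⊕-cong g₁ g₂ (meas-base e r₁ r₂ _) f

  -- Partial sums form a sub-effect algebra with the RDP

  module Generated (b : Base 1#) where

    -- Boolean labels suffice: any labelled tree can be relabelled by the predicate that selects the
    -- sum.
    Measured : Pred Carrier ℓ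
    Measured x = ∃ λ (t : Tree Bool b) → meas t id ≈ x

    meas∈ : (t : Tree A b) (φ : A → Bool) → meas t φ ∈ Measured
    meas∈ t φ = relabel φ t , meas-relabel φ t id

    Measured-resp-≈ : x ≈ y → x ∈ Measured → y ∈ Measured
    Measured-resp-≈ e (t , f) = t , trans f e

    data Side : Set where
      left right neither : Side

    isLeft isRight isEither isNeither : Side → Bool
    isLeft left = true
    isLeft _    = false
    isRight right = true
    isRight _     = false
    isNeither neither = true
    isNeither _       = false
    isEither = not ∘ isNeither

    either : ∀ a → Split (isLeft a) (isRight a) (isEither a)
    either left    = inˡ
    either right   = inʳ
    either neither = none

    both onlyʳ outside : Bool × Bool → Bool
    both    (i , j) = i ∧ j
    onlyʳ   (i , j) = not i ∧ j
    outside (i , j) = not i ∧ not j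

    onlyʳ-both : ∀ a → Split (onlyʳ a) (both a) (proj₂ a)
    onlyʳ-both (true  , true ) = inʳ
    onlyʳ-both (true  , false) = none
    onlyʳ-both (false , true ) = inˡ
    onlyʳ-both (false , false) = none

    -- Orthogonality says `meas r proj₂ ≤ meas r proj₁ ′`. Both sides contain `onlyʳ`, and
    -- cancelling it leaves the claim.
    both-≤ : (r : Tree (Bool × Bool) b) → Defined (meas r proj₁) (meas r proj₂) →
             meas r both ≤ meas r outside
    both-≤ r (_ , e) = ⊕-cancelˡ-≤
      (meas-⊕ r onlyʳ both proj₂ onlyʳ-both)
      (meas-⊕ r onlyʳ outside (not ∘ proj₁) λ (i , j) → split-∧ (not i) j)
      (≤-resp-≈ refl
        (⊕-cancelˡ (′-⊕ _) (respᵒ (meas-full r)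
          (meas-⊕ r proj₁ (not ∘ proj₁) (const true) λ (i , _) → split-∧ true i)))
        (defined⇒≤′ (⊕-comm e)))

    outside-≤-both′ : (r : Tree (Bool × Bool) b) →
                      meas r outside ≤ meas r both ′
    outside-≤-both′ r = defined⇒≤′
      (meas-⊕ r outside both (λ a → outside a ∨ both a) disjoint)
      where
      disjoint : ∀ a → Split (outside a) (both a) (outside a ∨ both a)
      disjoint (true  , true ) = inʳ
      disjoint (true  , false) = none
      disjoint (false , true ) = none
      disjoint (false , false) = inˡ

    -- The pair records membership in the two summands of `separate`, the last label marks the
    -- carved copy of their overlap. The overlap itself goes to the left, its copy to the right.
    sides : (Bool × Bool) × Bool → Side
    sides ((true  , _    ) , _    ) = left
    sides ((false , true ) , _    ) = right
    sides ((false , false) , true ) = right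
    sides ((false , false) , false) = neither

    isLeft-sides : ∀ a → isLeft (sides a) ≡ proj₁ (proj₁ a)
    isLeft-sides ((true  , _    ) , _    ) = refl′
    isLeft-sides ((false , true ) , _    ) = refl′
    isLeft-sides ((false , false) , true ) = refl′
    isLeft-sides ((false , false) , false) = refl′

    isRight-sides : ∀ a → Split (onlyʳ (proj₁ a)) (outside (proj₁ a) ∧ proj₂ a)
                                (isRight (sides a))
    isRight-sides ((true  , _    ) , _    ) = none
    isRight-sides ((false , true ) , _    ) = inˡ
    isRight-sides ((false , false) , true ) = inʳ
    isRight-sides ((false , false) , false) = none

    abstract
      -- The overlap of x and y lies below the part outside x and y, from which
      -- a second copy of it is carved.
      separate : x ∈ Measured → y ∈ Measured → x ⊕ y ⇓ z →
                 ∃ λ (t : Tree Side b) → meas t isLeft ≈ x × meas t isRight ≈ y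
      separate {x} {y} (s , s≈) (t , t≈) x⊕y with join s t
      ... | r , r₁ , r₂
        with carve r outside
               (both-≤ r (_ , ⊕-resp-≈ (sym (trans (r₁ id) s≈))
                                (sym (trans (r₂ id) t≈)) refl x⊕y))
               (outside-≤-both′ r)
      ... | u , u₁ , u₂ =
        relabel sides u ,
        trans (meas-relabel sides u isLeft)
          (trans (meas-cong u isLeft-sides)
            (trans (u₁ proj₁) (trans (r₁ id) s≈))) ,
        trans (meas-relabel sides u isRight)
          (trans (⊕-cong (u₁ onlyʳ) u₂
              (meas-⊕ u (onlyʳ ∘ proj₁) (λ (a , i) → outside a ∧ i)
                (isRight ∘ sides) isRight-sides)
              (meas-⊕ r onlyʳ both proj₂ onlyʳ-both))
            (trans (r₂ id) t≈))

    Measured-⊕ : x ∈ Measured → y ∈ Measured → x ⊕ y ⇓ z → z ∈ Measured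
    Measured-⊕ x∈ y∈ e with separate x∈ y∈ e
    ... | t , f , g = Measured-resp-≈
      (⊕-cong f g (meas-⊕ t isLeft isRight isEither either) e) (meas∈ t isEither)

    Measured-′ : x ∈ Measured → x ′ ∈ Measured
    Measured-′ (t , f) = Measured-resp-≈
      (⊕-cancelˡ (⊕-resp-≈ f refl (meas-full t)
        (meas-⊕ t id not (const true) (split-∧ true))) (′-⊕ _))
      (meas∈ t not)

    Measured-⊖ : x ∈ Measured → z ∈ Measured → x ⊕ y ⇓ z → y ∈ Measured
    Measured-⊖ x∈ z∈ e with ⊕-assocʳ (⊕-comm e) (′-⊕ _)
    ... | _ , f , g = Measured-resp-≈ (′-unique (⊕-comm g))
      (Measured-′ (Measured-⊕ x∈ (Measured-′ z∈) f))

    Measured-isSubEffectAlgebra : IsSubEffectAlgebra Measured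
    Measured-isSubEffectAlgebra = record
      { resp-≈    = Measured-resp-≈
      ; 1∈        = Measured-resp-≈ (meas-full (fill true b))
                      (meas∈ (fill true b) (const true))
      ; two⇒three = λ where
          e (inj₁ (x∈ , y∈))        → x∈ , y∈ , Measured-⊕ x∈ y∈ e
          e (inj₂ (inj₁ (x∈ , z∈))) → x∈ , Measured-⊖ x∈ z∈ e , z∈
          e (inj₂ (inj₂ (y∈ , z∈))) → Measured-⊖ y∈ z∈ (⊕-comm e) , y∈ , z∈
      }

    -- For the decomposition of some `u ≤ v₁ ⊕ v₂`: the `Side` places a piece in `v₁`, in `v₂` or in
    -- neither, and the Boolean says whether it belongs to `u`.
    kept new rest : Side × Bool → Bool
    kept (a , i) = isEither a ∧ i
    new  (a , i) = isNeither a ∧ i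
    rest (a , i) = isEither a ∧ not i

    kept-new : ∀ a → Split (kept a) (new a) (proj₂ a)
    kept-new (left    , true ) = inˡ
    kept-new (left    , false) = none
    kept-new (right   , true ) = inˡ
    kept-new (right   , false) = none
    kept-new (neither , true ) = inʳ
    kept-new (neither , false) = none

    rest-new : ∀ a → Split (rest a) (new a) (rest a ∨ new a)
    rest-new (left    , true ) = none
    rest-new (left    , false) = inˡ
    rest-new (right   , true ) = none
    rest-new (right   , false) = inˡ
    rest-new (neither , true ) = inʳ
    rest-new (neither , false) = none

    -- The part of u outside v₁ ⊕ v₂ fits into the part of v₁ ⊕ v₂ outside u;
    -- i marks the parts of u, j those carved out to replace its outer part.
    taken left-over : (Side → Bool) → (Side × Bool) × Bool → Bool
    taken     σ ((a , i) , j) = σ a ∧ (i ∨ j)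
    left-over σ ((a , i) , j) = σ a ∧ not (i ∨ j)

    taken-sides : ∀ a → Split (taken isLeft a) (taken isRight a) (taken isEither a)
    taken-sides ((left    , true ) , _    ) = inˡ
    taken-sides ((left    , false) , true ) = inˡ
    taken-sides ((left    , false) , false) = none
    taken-sides ((right   , true ) , _    ) = inʳ
    taken-sides ((right   , false) , true ) = inʳ
    taken-sides ((right   , false) , false) = none
    taken-sides ((neither , _    ) , _    ) = none

    taken-kept : ∀ a → Split (kept (proj₁ a)) (rest (proj₁ a) ∧ proj₂ a)
                             (taken isEither a)
    taken-kept ((left    , true ) , _    ) = inˡ
    taken-kept ((left    , false) , true ) = inʳ
    taken-kept ((left    , false) , false) = none
    taken-kept ((right   , true ) , _    ) = inˡ
    taken-kept ((right   , false) , true ) = inʳ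
    taken-kept ((right   , false) , false) = none
    taken-kept ((neither , _    ) , _    ) = none

    Measured-rdp : PartialMagma.RDP (partialMagma ↾ Measured)
    Measured-rdp {u , t , t≈} {v₁ , v₁∈} {v₂ , v₂∈} {v , _} v₁⊕v₂ (_ , u≤v)
      with separate v₁∈ v₂∈ v₁⊕v₂
    ... | s , s₁ , s₂ with join s t
    ... | r , r₁ , r₂
      -- Cancelling `kept` from `u ≤ v` leaves `new ≤ rest`. As their labels are disjoint, `carve`
      -- finds a copy of `new` inside `rest`.
      with carve r rest
             (⊕-cancelˡ-≤ (meas-⊕ r kept new proj₂ kept-new)
               (meas-⊕ r kept rest (isEither ∘ proj₁)
                 λ (a , i) → split-∧ (isEither a) i)
               (≤-resp-≈ (sym (trans (r₂ id) t≈)) (sym (trans (r₁ isEither)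
                   (⊕-cong s₁ s₂ (meas-⊕ s isLeft isRight isEither either) v₁⊕v₂)))
                 (_ , u≤v)))
             (defined⇒≤′ (meas-⊕ r rest new (λ a → rest a ∨ new a) rest-new))
    ... | q , q₁ , q₂ =
      (_ , meas∈ q (taken isLeft)) , (_ , meas∈ q (taken isRight)) ,
      ((_ , meas∈ q (left-over isLeft)) , part isLeft (trans (r₁ isLeft) s₁)) ,
      ((_ , meas∈ q (left-over isRight)) , part isRight (trans (r₁ isRight) s₂)) ,
      respᵒ whole
        (meas-⊕ q (taken isLeft) (taken isRight) (taken isEither) taken-sides)
      where
      part : ∀ σ {v} → meas r (σ ∘ proj₁) ≈ v →
             meas q (taken σ) ⊕ meas q (left-over σ) ⇓ v
      part σ e = respᵒ (trans (q₁ (σ ∘ proj₁)) e)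
        (meas-⊕ q (taken σ) (left-over σ) (σ ∘ proj₁ ∘ proj₁)
          λ ((a , i) , j) → split-∧ (σ a) (i ∨ j))
      whole : meas q (taken isEither) ≈ u
      whole = trans (⊕-cong (q₁ kept) q₂
          (meas-⊕ q (kept ∘ proj₁) (λ (a , i) → rest a ∧ i) (taken isEither)
            taken-kept)
          (meas-⊕ r kept new proj₂ kept-new))
        (trans (r₂ id) t≈)

-- The union of a chain of subsets of E lives one universe above E; excluded
-- middle brings it back down.
module _ (em : ∀ ℓ → ExcludedMiddle ℓ) where

  Resize : ∀ {k} ℓ → Set k → Set ℓ
  Resize {k} ℓ P with em k {P}
  ... | yes _ = Lift ℓ ⊤
  ... | no  _ = Lift ℓ ⊥

  resize : ∀ {k ℓ} {P : Set k} → P → Resize ℓ P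
  resize {k} {ℓ} {P} p with em k {P}
  ... | yes _ = lift tt
  ... | no ¬p = contradiction p ¬p

  unresize : ∀ {k ℓ} {P : Set k} → Resize ℓ P → P
  unresize {k} {ℓ} {P} r with em k {P} | r
  ... | yes p | _ = p
  ... | no  _ | lift ()

-- Extending subalgebras with the RDP to blocks

module BlockExistence (axioms : ClassicalAxioms) {ℓ} (E : EffectAlgebra ℓ) where

  open ClassicalAxioms axioms
  open EffectAlgebra E

  IsRieszSubalgebra : Pred Carrier ℓ → Set ℓ
  IsRieszSubalgebra Q =
    IsSubEffectAlgebra Q × PartialMagma.RDP (partialMagma ↾ Q)

  module _ {B₀ : Pred Carrier ℓ} (B₀-riesz : IsRieszSubalgebra B₀) where

    Extension : Set (suc ℓ)
    Extension = ∃ λ (Q : Pred Carrier ℓ) → B₀ ⊆ Q × IsRieszSubalgebra Q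

    extensions : Poset (suc ℓ) ℓ ℓ
    extensions = record
      { Carrier = Extension
      ; _≈_     = λ P Q → proj₁ P ≐ proj₁ Q
      ; _≤_     = λ P Q → proj₁ P ⊆ proj₁ Q
      ; isPartialOrder = record
        { isPreorder = record
          { isEquivalence = record
            { refl  = id , id
            ; sym   = λ (f , g) → g , f
            ; trans = λ (f , g) (f₁ , g₁) → f₁ ∘ f , g ∘ g₁
            }
          ; reflexive = proj₁
          ; trans     = λ f g → g ∘ f
          }
        ; antisym = _,_
        }
      }

    module _ (C : Pred Extension ℓ) (chain : IsChain extensions C) where

      -- Adjoining B₀ makes the chain nonempty.
      Member : Set (suc ℓ)
      Member = ⊤ ⊎ ∃ C

      set : Member → Pred Carrier ℓ
      set (inj₁ _)             = B₀
      set (inj₂ ((Q , _) , _)) = Q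

      riesz : ∀ i → IsRieszSubalgebra (set i)
      riesz (inj₁ _)                     = B₀-riesz
      riesz (inj₂ ((_ , _ , Q-riesz) , _)) = Q-riesz

      ⊆-total : ∀ i j → set i ⊆ set j ⊎ set j ⊆ set i
      ⊆-total (inj₁ _)                 (inj₁ _)                 = inj₁ id
      ⊆-total (inj₁ _)                 (inj₂ ((_ , B₀⊆Q , _) , _)) = inj₁ B₀⊆Q
      ⊆-total (inj₂ ((_ , B₀⊆Q , _) , _)) (inj₁ _)                 = inj₂ B₀⊆Q
      ⊆-total (inj₂ (_ , p))           (inj₂ (_ , q))           = chain p q

      ⊆-directed : ∀ i j → ∃ λ k → set i ⊆ set k × set j ⊆ set k
      ⊆-directed i j with ⊆-total i j
      ... | inj₁ i⊆j = j , i⊆j , id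
      ... | inj₂ j⊆i = i , id , j⊆i

      ⋃ : Pred Carrier ℓ
      ⋃ x = Resize excludedMiddle ℓ (∃ λ i → x ∈ set i)

      ⊆⋃ : ∀ i → set i ⊆ ⋃
      ⊆⋃ i x∈ = resize excludedMiddle (i , x∈)

      member : ∀ {x} → x ∈ ⋃ → ∃ λ i → x ∈ set i
      member = unresize excludedMiddle

      member₂ : ∀ {x y} → x ∈ ⋃ → y ∈ ⋃ → ∃ λ i → x ∈ set i × y ∈ set i
      member₂ x∈ y∈ with member x∈ | member y∈
      ... | i , x∈i | j , y∈j with ⊆-directed i j
      ... | k , i⊆k , j⊆k = k , i⊆k x∈i , j⊆k y∈j

      member₃ : ∀ {x y z} → x ∈ ⋃ → y ∈ ⋃ → z ∈ ⋃ →
                ∃ λ i → x ∈ set i × y ∈ set i × z ∈ set i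
      member₃ x∈ y∈ z∈ with member₂ x∈ y∈ | member z∈
      ... | i , x∈i , y∈i | j , z∈j with ⊆-directed i j
      ... | k , i⊆k , j⊆k = k , i⊆k x∈i , i⊆k y∈i , j⊆k z∈j

      -- Each instance of the axioms involves finitely many elements, which by directedness lie in
      -- one member of the chain.
      ⋃-riesz : IsRieszSubalgebra ⋃
      ⋃-riesz = record
        { resp-≈    = λ x≈y x∈ → let i , x∈i = member x∈ in
            ⊆⋃ i (IsSubEffectAlgebra.resp-≈ (proj₁ (riesz i)) x≈y x∈i)
        ; 1∈        = ⊆⋃ (inj₁ tt) (IsSubEffectAlgebra.1∈ (proj₁ B₀-riesz))
        ; two⇒three = λ where
            e (inj₁ (x∈ , y∈)) → let i , x∈i , y∈i = member₂ x∈ y∈ in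
              three i e (inj₁ (x∈i , y∈i))
            e (inj₂ (inj₁ (x∈ , z∈))) → let i , x∈i , z∈i = member₂ x∈ z∈ in
              three i e (inj₂ (inj₁ (x∈i , z∈i)))
            e (inj₂ (inj₂ (y∈ , z∈))) → let i , y∈i , z∈i = member₂ y∈ z∈ in
              three i e (inj₂ (inj₂ (y∈i , z∈i)))
        } , λ {u} {v₁} {v₂} {v} → rdp {u} {v₁} {v₂} {v}
        where
        three : ∀ i {x y z} → x ⊕ y ⇓ z →
                (x ∈ set i × y ∈ set i) ⊎ (x ∈ set i × z ∈ set i) ⊎
                  (y ∈ set i × z ∈ set i) →
                x ∈ ⋃ × y ∈ ⋃ × z ∈ ⋃
        three i e two
          with IsSubEffectAlgebra.two⇒three (proj₁ (riesz i)) e two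
        ... | x∈ , y∈ , z∈ = ⊆⋃ i x∈ , ⊆⋃ i y∈ , ⊆⋃ i z∈

        rdp : PartialMagma.RDP (partialMagma ↾ ⋃)
        rdp {_ , u∈} {_ , v₁∈} {_ , v₂∈} v₁⊕v₂ (_ , u≤v)
          -- `v` and then the difference of `v` and `u` follow into the same member by closure.
          with member₃ u∈ v₁∈ v₂∈
        ... | i , u∈i , v₁∈i , v₂∈i
          with IsSubEffectAlgebra.two⇒three (proj₁ (riesz i)) v₁⊕v₂
                 (inj₁ (v₁∈i , v₂∈i))
        ... | _ , _ , v∈i
          with IsSubEffectAlgebra.two⇒three (proj₁ (riesz i)) u≤v
                 (inj₂ (inj₁ (u∈i , v∈i)))
        ... | _ , d∈i , _
          with proj₂ (riesz i) {_ , u∈i} {_ , v₁∈i} {_ , v₂∈i} {_ , v∈i}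
                 v₁⊕v₂ ((_ , d∈i) , u≤v)
        ... | (_ , u₁∈) , (_ , u₂∈) , ((_ , d₁∈) , e₁) , ((_ , d₂∈) , e₂) , e =
          (_ , ⊆⋃ i u₁∈) , (_ , ⊆⋃ i u₂∈) ,
          ((_ , ⊆⋃ i d₁∈) , e₁) , ((_ , ⊆⋃ i d₂∈) , e₂) , e

      upperBound : ∃ (IsUpperBound extensions C)
      upperBound = (⋃ , ⊆⋃ (inj₁ tt) , ⋃-riesz) , λ p → ⊆⋃ (inj₂ (_ , p))

    -- A subalgebra with the RDP that contains a maximal extension of `B₀` is itself an extension of
    -- `B₀`, so maximality among extensions is maximality among all.
    block-⊇ : ∃ λ B → IsBlock B × B₀ ⊆ B
    block-⊇ with zornsLemma _ _ _ ℓ extensions upperBound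
    ... | (B , B₀⊆B , B-sub , B-rdp) , max = B , record
      { isSubEffectAlgebra = B-sub
      ; rdp                = λ {u} {v₁} {v₂} {v} → B-rdp {u} {v₁} {v₂} {v}
      ; maximal            = λ {C} C-sub C-rdp B⊆C →
          max {C , B⊆C ∘ B₀⊆B , C-sub ,
            λ {u} {v₁} {v₂} {v} → C-rdp {u} {v₁} {v₂} {v}} B⊆C
      } , B₀⊆B

  orthogonal⇒block : Homogeneous → ∀ {x y z} → x ⊕ y ⇓ z →
                     ∃ λ B → IsBlock B × x ∈ B × y ∈ B
  orthogonal⇒block hom {x} {y} {z} e =
    let B , B-block , B₀⊆B =
          block-⊇ (Measured-isSubEffectAlgebra ,
            λ {u} {v₁} {v₂} {v} → Measured-rdp {u} {v₁} {v₂} {v})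
    in B , B-block ,
       B₀⊆B (Measured-resp-≈ x≈ (meas∈ pieces isLeft)) ,
       B₀⊆B (Measured-resp-≈ y≈ (meas∈ pieces isRight))
    where
    open EffectAlgebraProperties E
    open HomogeneousBlocks E hom
    open Generated (split (′-⊕ z) (split e (atom x) (atom y)) (atom (z ′)))
    pieces = base (base (leaf left) (leaf right)) (leaf neither)
    x≈ : meas pieces isLeft ≈ x
    x≈ = ⊕-cong
      (⊕-cong (meas-leaf left isLeft) (meas-leaf right isLeft)
        (meas-base e _ _ isLeft) (⊕-identityʳ x))
      (meas-leaf neither isLeft) (meas-base _ _ _ isLeft) (⊕-identityʳ x)
    y≈ : meas pieces isRight ≈ y
    y≈ = ⊕-cong
      (⊕-cong (meas-leaf left isRight) (meas-leaf right isRight)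
        (meas-base e _ _ isRight) (⊕-identityˡ y))
      (meas-leaf neither isRight) (meas-base _ _ _ isRight) (⊕-identityʳ y)

-- Sharp and meager parts

module TRTProperties {ℓ} (E : TRTEffectAlgebra ℓ) where

  open TRTEffectAlgebra E
  open EffectAlgebraProperties effectAlgebra public

  ⌊⌋-≤ : ∀ x → proj₁ ⌊ x ⌋ ≤ x
  ⌊⌋-≤ x = IsLargestSharpBelow.below (proj₂ (largestSharpBelow sharplyDominating x))

  ⌊⌋-greatest : ∀ {x t} → t ∈ Sharp → t ≤ x → t ≤ proj₁ ⌊ x ⌋
  ⌊⌋-greatest {x} =
    IsLargestSharpBelow.greatest (proj₂ (largestSharpBelow sharplyDominating x))

  ⌈⌉-≥ : ∀ x → x ≤ proj₁ ⌈ x ⌉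
  ⌈⌉-≥ x = IsSmallestSharpAbove.above (proj₂ (sharplyDominating x))

  ⌈⌉-least : ∀ {x t} → t ∈ Sharp → x ≤ t → proj₁ ⌈ x ⌉ ≤ t
  ⌈⌉-least {x} = IsSmallestSharpAbove.least (proj₂ (sharplyDominating x))

  ⌈⌉-mono : ∀ {x y} → x ≤ y → proj₁ ⌈ x ⌉ ≤ proj₁ ⌈ y ⌉
  ⌈⌉-mono {x} {y} x≤y = ⌈⌉-least (proj₂ ⌈ y ⌉) (≤-trans x≤y (⌈⌉-≥ y))

  ⌈⌉-cong : ∀ {x y} → x ≈ y → ⌈ x ⌉ S.≈ ⌈ y ⌉
  ⌈⌉-cong e = ≤-antisym (⌈⌉-mono (≤-reflexive e)) (⌈⌉-mono (≤-reflexive (sym e)))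

  abstract
    -- For sharp `v` below the remainder, `⌊ x ⌋ ⊕ v` is sharp and below `x`, hence below `⌊ x ⌋`,
    -- and `v` is zero.
    meagerPart : Carrier → M.Carrier
    meagerPart x = proj₁ (⌊⌋-≤ x) , λ v∈S (_ , e) →
      let _ , f , g = ⊕-assocˡ e (proj₂ (⌊⌋-≤ x))
          ⌊x⌋⊕v≤⌊x⌋ = ⌊⌋-greatest (Sharp-⊕ homogeneous (proj₂ ⌊ x ⌋) v∈S f) (⇓⇒≤ˡ g)
      in ≤0⇒≈0 (⊕-cancelˡ-≤ f (⊕-identityʳ _) ⌊x⌋⊕v≤⌊x⌋)

    ⌊⌋-⊕ : ∀ x → proj₁ ⌊ x ⌋ ⊕ proj₁ (meagerPart x) ⇓ x
    ⌊⌋-⊕ x = proj₂ (⌊⌋-≤ x)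

  -- The difference of `⌊ x ⌋` and `s` is sharp and, after cancelling `s`, lies below the meager
  -- `m`; so it is zero.
  ⌊⌋-unique : ∀ {s m x} → s ∈ Sharp → m ∈ Meager → s ⊕ m ⇓ x → proj₁ ⌊ x ⌋ ≈ s
  ⌊⌋-unique {s} {m} {x} s∈S m∈M e with ⌊⌋-greatest s∈S (⇓⇒≤ˡ e)
  ... | d , f = sym (⊕-functional (⊕-identityʳ s) (respʳ d≈0 f))
    where
    d≈0 : d ≈ 0#
    d≈0 = m∈M (Sharp-⊖ homogeneous s∈S (proj₂ ⌊ x ⌋) f)
      (⊕-cancelˡ-≤ f e (⌊⌋-≤ x))

  meagerPart-unique : ∀ {s m x} → s ∈ Sharp → m ∈ Meager → s ⊕ m ⇓ x →
                      proj₁ (meagerPart x) ≈ m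
  meagerPart-unique s∈S m∈M e =
    ⊕-cancelˡ (respˡ (⌊⌋-unique s∈S m∈M e) (⌊⌋-⊕ _)) e

  -- The difference of `r` and `⌈ m ⌉` is sharp and lies below that of `r` and `m`, which is the
  -- meager `n`; so it is zero.
  meager-⊕-sharp : ∀ {m n r} → n ∈ Meager → r ∈ Sharp → m ⊕ n ⇓ r → r ≈ proj₁ ⌈ m ⌉
  meager-⊕-sharp {m} n∈M r∈S e with ⌈⌉-least r∈S (⇓⇒≤ˡ e)
  ... | d , f = ⊕-functional f
    (respʳ (sym (n∈M (Sharp-⊖ homogeneous (proj₂ ⌈ m ⌉) r∈S f) d≤n)) (⊕-identityʳ _))
    where
    d≤n : d ≤ _
    d≤n with ⌈⌉-≥ m
    ... | _ , g with ⊕-assocʳ g f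
    ... | _ , h₁ , h₂ = ≤-resp-≈ refl (⊕-cancelˡ h₂ e) (⇓⇒≤ʳ h₁)

  -- A two-by-two matrix with row sums `x`, `y` and column sums `s`, `m`.
  record Refinement (x y s m : Carrier) : Set ℓ where
    field
      {x₁ x₂ y₁ y₂} : Carrier
      x₁⊕x₂ : x₁ ⊕ x₂ ⇓ x
      y₁⊕y₂ : y₁ ⊕ y₂ ⇓ y
      x₁⊕y₁ : x₁ ⊕ y₁ ⇓ s
      x₂⊕y₂ : x₂ ⊕ y₂ ⇓ m

  -- A block containing x and y contains x ⊕ y, hence also the sharp part of
  -- x ⊕ y, which therefore splits along x and y.
  ⊕-refinement : ClassicalAxioms → ∀ {x y z} → x ⊕ y ⇓ z →
                 Refinement x y (proj₁ ⌊ z ⌋) (proj₁ (meagerPart z))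
  ⊕-refinement axioms {x} {y} {z} e
    with BlockExistence.orthogonal⇒block axioms effectAlgebra homogeneous e
  ... | B , B-block , x∈ , y∈
    with IsBlock.isSubEffectAlgebra B-block
  ... | B-sub with IsSubEffectAlgebra.two⇒three B-sub e (inj₁ (x∈ , y∈))
  -- Condition (1) on TRT-effect algebras, at the lower end of the interval.
  ... | _ , _ , z∈ with block-interval B-block z∈ ≤-refl (⌊⌋-≤ z)
  ... | ⌊z⌋∈
    with IsSubEffectAlgebra.two⇒three B-sub (⌊⌋-⊕ z) (inj₂ (inj₁ (⌊z⌋∈ , z∈)))
  ... | _ , m∈ , _
    with IsBlock.rdp B-block {_ , ⌊z⌋∈} {_ , x∈} {_ , y∈} {_ , z∈} e ((_ , m∈) , ⌊⌋-⊕ z)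
  ... | _ , _ , (_ , f) , (_ , g) , k with interchange f g e
  ... | _ , _ , k₁ , l , j = record
    { x₁⊕x₂ = f
    ; y₁⊕y₂ = g
    ; x₁⊕y₁ = k
    ; x₂⊕y₂ = respᵒ (⊕-cancelˡ (respˡ (⊕-functional k₁ k) j) (⌊⌋-⊕ z)) l
    }

-- Isomorphisms of triples

invert : ∀ {ℓ} {E F : TRTEffectAlgebra ℓ} → TripleIsomorphism E F → TripleIsomorphism F E
invert {E = E} {F} τ = record
  { σ = record
    { to              = σ.from
    ; from            = σ.to
    ; to-isMorphism   = σ.from-isMorphism
    ; from-isMorphism = σ.to-isMorphism
    ; inverse         = proj₂ σ.inverse , proj₁ σ.inverse
    }
  ; μ = record
    { to        = μ⁻¹
    ; cong      = λ {x} {y} e → injective {μ⁻¹ x} {μ⁻¹ y} (F.trans (μμ⁻¹ _) (F.trans e (F.sym (μμ⁻¹ _))))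
    ; bijective =
        (λ {x} {y} e → F.trans (F.sym (μμ⁻¹ x))
          (F.trans (μ.cong {μ⁻¹ x} {μ⁻¹ y} e) (μμ⁻¹ y))) ,
        (λ x → μ.to x , λ {z} e → injective {μ⁻¹ z} {x} (F.trans (μμ⁻¹ z) e))
    ; 0-homo    = injective {μ⁻¹ F.M.0#} {E.M.0#} (F.trans (μμ⁻¹ _) (F.sym μ.0-homo))
    ; ⊕-defined = λ x y → mk⇔
        (λ (z , e) → μ⁻¹ z , μ⁻¹-⊕ {x} {y} {z} e)
        (λ (z , e) → μ.to z , F.⊕-resp-≈ (μμ⁻¹ x) (μμ⁻¹ y) F.refl (μ.⊕-homo {μ⁻¹ x} {μ⁻¹ y} {z} e))
    ; ⊕-homo    = λ {x} {y} {z} → μ⁻¹-⊕ {x} {y} {z}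
    }
  ; h-compatible = λ s →
      (λ {y} (x , x≤s , e) →
        let x₁ , x₁≤ , e₁ = proj₂ (h-compatible (σ.from s)) {x}
              (FP.≤-trans x≤s (FP.≤-reflexive (F.sym (σσ⁻¹ s))))
        in E.≤-resp-≈ (E.trans (injective {x₁} {μ⁻¹ x} (F.trans e₁ (F.sym (μμ⁻¹ x)))) e) E.refl x₁≤) ,
      (λ {y} y≤ → μ.to y ,
        F.≤-resp-≈ F.refl (σσ⁻¹ s) (proj₁ (h-compatible (σ.from s)) {μ.to y} (y , y≤ , F.refl)) ,
        injective {μ⁻¹ (μ.to y)} {y} (μμ⁻¹ (μ.to y)))
  }
  where
  module E = TRTEffectAlgebra E
  module F = TRTEffectAlgebra F
  module FP = TRTProperties F
  open TripleIsomorphism τ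
  module σ = EffectAlgebraIsomorphism σ
  module μ = GeneralizedEffectAlgebraIsomorphism μ

  injective : ∀ {x y} → μ.to x F.M.≈ μ.to y → x E.M.≈ y
  injective = proj₁ μ.bijective

  μ⁻¹ : F.M.Carrier → E.M.Carrier
  μ⁻¹ y = proj₁ (proj₂ μ.bijective y)

  μμ⁻¹ : ∀ y → μ.to (μ⁻¹ y) F.M.≈ y
  μμ⁻¹ y = proj₂ (proj₂ μ.bijective y) E.refl

  σσ⁻¹ : ∀ s → σ.to (σ.from s) F.S.≈ s
  σσ⁻¹ s = proj₁ σ.inverse E.refl

  -- `μ` reflects definedness, and injectivity identifies the sum so obtained with `μ⁻¹ z`.
  μ⁻¹-⊕ : ∀ {x y z} → x F.M.⊕ y ⇓ z → μ⁻¹ x E.M.⊕ μ⁻¹ y ⇓ μ⁻¹ z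
  μ⁻¹-⊕ {x} {y} {z} e
    with Equivalence.from (μ.⊕-defined (μ⁻¹ x) (μ⁻¹ y))
           (z , F.⊕-resp-≈ (F.sym (μμ⁻¹ x)) (F.sym (μμ⁻¹ y)) F.refl e)
  ... | w , f = E.⊕-resp-≈ E.refl E.refl
    (injective {w} {μ⁻¹ z}
      (F.trans (FP.⊕-cong (μμ⁻¹ x) (μμ⁻¹ y) (μ.⊕-homo {μ⁻¹ x} {μ⁻¹ y} {w} f) e)
        (F.sym (μμ⁻¹ z)))) f

module TripleMap {ℓ} {E F : TRTEffectAlgebra ℓ} (τ : TripleIsomorphism E F) where

  private
    module E = TRTEffectAlgebra E
    module F = TRTEffectAlgebra F
    module EP = TRTProperties E
    module FP = TRTProperties F
  open TripleIsomorphism τ using (h-compatible)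
  open EffectAlgebraIsomorphism (TripleIsomorphism.σ τ) public
    using () renaming (to to σ; to-isMorphism to σ-isMorphism)
  open IsEffectAlgebraMorphism σ-isMorphism public
    using () renaming (cong to σ-cong; 1-homo to σ-1; ⊕-homo to σ-⊕)
  open GeneralizedEffectAlgebraIsomorphism (TripleIsomorphism.μ τ) public
    using () renaming (to to μ; cong to μ-cong; 0-homo to μ-0; ⊕-homo to μ-⊕)

  σ-≤ : ∀ {s t} → proj₁ s E.≤ proj₁ t → proj₁ (σ s) F.≤ proj₁ (σ t)
  σ-≤ {s} {t} (d , e) =
    _ , σ-⊕ {s} {d , EP.Sharp-⊖ E.homogeneous (proj₂ s) (proj₂ t) e} {t} e

  μ-≤ : ∀ {m n} → proj₁ m E.≤ proj₁ n → proj₁ (μ m) F.≤ proj₁ (μ n)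
  μ-≤ {m} {n} (d , e) =
    _ , μ-⊕ {m} {d , EP.Meager-≤ (EP.⇓⇒≤ʳ e) (proj₂ n)} {n} e

  μ-h : ∀ {m s} → m ∈ E.h s → μ m ∈ F.h (σ s)
  μ-h {m} {s} m≤s = proj₁ (h-compatible s) {μ m} (m , m≤s , F.refl)

  σ-′ : ∀ s → proj₁ (σ (proj₁ s E.′ , E.Sharp-′ (proj₂ s))) F.≈ proj₁ (σ s) F.′
  σ-′ s = F.sym (F.′-unique (FP.respᵒ σ-1 (σ-⊕ {s} {_ , E.Sharp-′ (proj₂ s)} {E.S.1#} (E.′-⊕ (proj₁ s)))))

  abstract
    -- Here `h` enters. A meager element is orthogonal to a sharp `s` exactly when it lies in `h` of
    -- the orthosupplement of `s`; this membership is carried to `F`, and `σ` commutes with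
    -- orthosupplements.
    to-defined : ∀ x → F.Defined (proj₁ (σ E.⌊ x ⌋)) (proj₁ (μ (EP.meagerPart x)))
    to-defined x =
      let y , e = FP.≤′⇒defined (F.≤-resp-≈ F.refl (σ-′ E.⌊ x ⌋)
            (μ-h {EP.meagerPart x} {_ , E.Sharp-′ (proj₂ E.⌊ x ⌋)}
              (EP.defined⇒≤′ (E.⊕-comm (EP.⌊⌋-⊕ x)))))
      in y , F.⊕-comm e

    to : E.Carrier → F.Carrier
    to x = proj₁ (to-defined x)

    to-⊕ : ∀ x → proj₁ (σ E.⌊ x ⌋) F.⊕ proj₁ (μ (EP.meagerPart x)) ⇓ to x
    to-⊕ x = proj₂ (to-defined x)

  to-unique : ∀ s m {x} → proj₁ s E.⊕ proj₁ m ⇓ x →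
              proj₁ (σ s) F.⊕ proj₁ (μ m) ⇓ to x
  to-unique s m {x} e = F.⊕-resp-≈
    (σ-cong {E.⌊ x ⌋} {s} (EP.⌊⌋-unique (proj₂ s) (proj₂ m) e))
    (μ-cong {EP.meagerPart x} {m} (EP.meagerPart-unique (proj₂ s) (proj₂ m) e))
    F.refl (to-⊕ x)

  to-cong : ∀ {x y} → x E.≈ y → to x F.≈ to y
  to-cong {x} {y} x≈y = F.⊕-functional (to-⊕ x)
    (to-unique E.⌊ x ⌋ (EP.meagerPart x) (EP.respᵒ x≈y (EP.⌊⌋-⊕ x)))

  -- Adding a sharp element changes the sharp part only: `s ⊕ x = (s ⊕ ⌊ x ⌋) ⊕ m` with `m` the
  -- meager part of `x`.
  σ-⊕-to : ∀ s {x z} → proj₁ s E.⊕ x ⇓ z → proj₁ (σ s) F.⊕ to x ⇓ to z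
  σ-⊕-to s {x} e =
    let a , s⊕⌊x⌋ , a⊕m = E.⊕-assocˡ (EP.⌊⌋-⊕ x) e
        aₛ = a , EP.Sharp-⊕ E.homogeneous (proj₂ s) (proj₂ E.⌊ x ⌋) s⊕⌊x⌋
        _ , f , g = F.⊕-assocʳ (σ-⊕ {s} {E.⌊ x ⌋} {aₛ} s⊕⌊x⌋)
                      (to-unique aₛ (EP.meagerPart x) a⊕m)
    in FP.respʳ (F.⊕-functional f (to-⊕ x)) g

-- Symmetric in the two triple isomorphisms, so that `swap` yields each transport lemma in the
-- opposite direction.
record Inverses {ℓ} {E F : TRTEffectAlgebra ℓ}
  (τ : TripleIsomorphism E F) (τ⁻¹ : TripleIsomorphism F E) : Set ℓ where
  private
    module E = TRTEffectAlgebra E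
    module F = TRTEffectAlgebra F
    module T = TripleMap τ
    module T⁻¹ = TripleMap τ⁻¹
  field
    σ⁻¹σ : ∀ s → T⁻¹.σ (T.σ s) E.S.≈ s
    σσ⁻¹ : ∀ s → T.σ (T⁻¹.σ s) F.S.≈ s
    μ⁻¹μ : ∀ m → T⁻¹.μ (T.μ m) E.M.≈ m
    μμ⁻¹ : ∀ m → T.μ (T⁻¹.μ m) F.M.≈ m

swap : ∀ {ℓ} {E F : TRTEffectAlgebra ℓ}
       {τ : TripleIsomorphism E F} {τ⁻¹ : TripleIsomorphism F E} →
       Inverses τ τ⁻¹ → Inverses τ⁻¹ τ
swap inv = record { σ⁻¹σ = σσ⁻¹ ; σσ⁻¹ = σ⁻¹σ ; μ⁻¹μ = μμ⁻¹ ; μμ⁻¹ = μ⁻¹μ }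
  where open Inverses inv

invert-inverses : ∀ {ℓ} {E F : TRTEffectAlgebra ℓ} (τ : TripleIsomorphism E F) →
                  Inverses τ (invert τ)
invert-inverses {E = E} {F} τ = record
  { σ⁻¹σ = λ s → proj₂ σ.inverse F.refl
  ; σσ⁻¹ = λ s → proj₁ σ.inverse E.refl
  ; μ⁻¹μ = λ m → proj₁ μ.bijective (μμ⁻¹ (μ.to m))
  ; μμ⁻¹ = μμ⁻¹
  }
  where
  module E = TRTEffectAlgebra E
  module F = TRTEffectAlgebra F
  module σ = EffectAlgebraIsomorphism (TripleIsomorphism.σ τ)
  module μ = GeneralizedEffectAlgebraIsomorphism (TripleIsomorphism.μ τ)
  μμ⁻¹ : ∀ m → μ.to (proj₁ (proj₂ μ.bijective m)) F.M.≈ m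
  μμ⁻¹ m = proj₂ (proj₂ μ.bijective m) E.refl

-- Transport of sharp covers, TRT conditions and sums

module _ {ℓ} {E F : TRTEffectAlgebra ℓ}
  {τ : TripleIsomorphism E F} {τ⁻¹ : TripleIsomorphism F E}
  (inv : Inverses τ τ⁻¹) where

  private
    module E = TRTEffectAlgebra E
    module F = TRTEffectAlgebra F
    module EP = TRTProperties E
    module FP = TRTProperties F
    module T = TripleMap τ
    module T⁻¹ = TripleMap τ⁻¹
  open Inverses inv

  from-to : ∀ x → T⁻¹.to (T.to x) E.≈ x
  from-to x = EP.⊕-cong (σ⁻¹σ E.⌊ x ⌋) (μ⁻¹μ (EP.meagerPart x))
    (T⁻¹.to-unique (T.σ E.⌊ x ⌋) (T.μ (EP.meagerPart x)) (T.to-⊕ x))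
    (EP.⌊⌋-⊕ x)

  -- The cover of `m` is the least `s` with `m ∈ h s`, a description by the triple alone. For one of
  -- the inequalities the cover of `μ m` is pulled back to `E`.
  σ-⌈⌉ : ∀ m → T.σ E.⌈ proj₁ m ⌉ F.S.≈ F.⌈ proj₁ (T.μ m) ⌉
  σ-⌈⌉ m = FP.≤-antisym
    (F.≤-resp-≈ F.refl (σσ⁻¹ F.⌈ proj₁ (T.μ m) ⌉)
      (T.σ-≤ {E.⌈ proj₁ m ⌉} {T⁻¹.σ F.⌈ proj₁ (T.μ m) ⌉}
        (EP.⌈⌉-least (proj₂ (T⁻¹.σ F.⌈ proj₁ (T.μ m) ⌉))
          (E.≤-resp-≈ (μ⁻¹μ m) E.refl (T⁻¹.μ-h {T.μ m} {F.⌈ proj₁ (T.μ m) ⌉} (FP.⌈⌉-≥ _))))))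
    (FP.⌈⌉-least (proj₂ (T.σ E.⌈ proj₁ m ⌉)) (T.μ-h {m} {E.⌈ proj₁ m ⌉} (EP.⌈⌉-≥ _)))

  μ-⌈⌉-cong : ∀ {m n} → E.⌈ proj₁ m ⌉ E.S.≈ E.⌈ proj₁ n ⌉ →
              F.⌈ proj₁ (T.μ m) ⌉ F.S.≈ F.⌈ proj₁ (T.μ n) ⌉
  μ-⌈⌉-cong {m} {n} e = F.trans (F.sym (σ-⌈⌉ m))
    (F.trans (T.σ-cong {E.⌈ proj₁ m ⌉} {E.⌈ proj₁ n ⌉} e) (σ-⌈⌉ n))

  μ-h-⌈⌉ : ∀ {m n} → m ∈ E.h E.⌈ proj₁ n ⌉ → T.μ m ∈ F.h F.⌈ proj₁ (T.μ n) ⌉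
  μ-h-⌈⌉ {m} {n} m≤ = F.≤-resp-≈ F.refl (σ-⌈⌉ n) (T.μ-h {m} {E.⌈ proj₁ n ⌉} m≤)

module _ {ℓ} {E F : TRTEffectAlgebra ℓ}
  {τ : TripleIsomorphism E F} {τ⁻¹ : TripleIsomorphism F E}
  (inv : Inverses τ τ⁻¹) where

  private
    module E = TRTEffectAlgebra E
    module F = TRTEffectAlgebra F
    module EP = TRTProperties E
    module FP = TRTProperties F
    module T = TripleMap τ
    module T⁻¹ = TripleMap τ⁻¹
  open Inverses inv

  -- Lower bounds of meager elements are meager, so every competing lower bound in `F` lies in `M`
  -- and can be pulled back.
  IsMeet-μ : ∀ x y m → E.IsMeet (proj₁ x) (proj₁ y) (proj₁ m) →
             F.IsMeet (proj₁ (T.μ x)) (proj₁ (T.μ y)) (proj₁ (T.μ m))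
  IsMeet-μ x y m meet = record
    { lowerˡ   = T.μ-≤ {m} {x} (E.IsMeet.lowerˡ meet)
    ; lowerʳ   = T.μ-≤ {m} {y} (E.IsMeet.lowerʳ meet)
    ; greatest = λ {w} w≤x w≤y →
        let w∈M = FP.Meager-≤ w≤x (proj₂ (T.μ x))
            w⁻  = T⁻¹.μ (w , w∈M)
        in F.≤-resp-≈ (μμ⁻¹ (w , w∈M)) F.refl
             (T.μ-≤ {w⁻} {m} (E.IsMeet.greatest meet
               (E.≤-resp-≈ E.refl (μ⁻¹μ x) (T⁻¹.μ-≤ {w , w∈M} {T.μ x} w≤x))
               (E.≤-resp-≈ E.refl (μ⁻¹μ y) (T⁻¹.μ-≤ {w , w∈M} {T.μ y} w≤y))))
    }

  -- The conditions involve only `M`, its meets, `h` and sharp covers, all of which the triple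
  -- determines.
  TRTConditions-μ : ∀ x {y} (c : E.TRTConditions x y) →
                    F.TRTConditions (T.μ x) (proj₁ (T.μ (y , E.TRTConditions.y∈M c)))
  TRTConditions-μ x {y} c = record
    { y∈M = proj₂ (T.μ yₘ)
    ; ŷ≈x̂ = μ-⌈⌉-cong inv {yₘ} {x} ŷ≈x̂
    ; x⊕[y⊖x∧y]∈h =
        let m , d , w , meet , e , f , w∈h = x⊕[y⊖x∧y]∈h in
        T.μ m , T.μ d , T.μ w , IsMeet-μ x yₘ m meet ,
        T.μ-⊕ {m} {d} {yₘ} e , T.μ-⊕ {x} {d} {w} f , μ-h-⌈⌉ inv {w} {x} w∈h
    -- As `z` ranges over elements of `F`, it is pulled back and tested in `E`, and the witnesses
    -- found there are carried forward.
    ; z⊕x∈h = λ z z∈h → mk⇔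
        (λ (w , e , w∈h) →
          let z⁻ = T⁻¹.μ z
              w⁻ = T⁻¹.μ w
              z≤y , d , f , d̂≈x̂ = Equivalence.to (z⊕x∈h z⁻ (h⁻ {z} z∈h))
                (w⁻ , EP.respʳ (μ⁻¹μ x) (T⁻¹.μ-⊕ {z} {T.μ x} {w} e) , h⁻ {w} w∈h)
          in F.≤-resp-≈ (μμ⁻¹ z) F.refl (T.μ-≤ {z⁻} {yₘ} z≤y) ,
             T.μ d , FP.respˡ (μμ⁻¹ z) (T.μ-⊕ {z⁻} {d} {yₘ} f) , μ-⌈⌉-cong inv {d} {x} d̂≈x̂)
        (λ (z≤y , d , f , d̂≈x̂) →
          let z⁻ = T⁻¹.μ z
              d⁻ = T⁻¹.μ d
              w , e , w∈h = Equivalence.from (z⊕x∈h z⁻ (h⁻ {z} z∈h))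
                ( E.≤-resp-≈ E.refl (μ⁻¹μ yₘ) (T⁻¹.μ-≤ {z} {T.μ yₘ} z≤y) , d⁻
                , EP.respᵒ (μ⁻¹μ yₘ) (T⁻¹.μ-⊕ {z} {d} {T.μ yₘ} f)
                , E.trans (μ-⌈⌉-cong (swap inv) {d} {T.μ x} d̂≈x̂) (EP.⌈⌉-cong (μ⁻¹μ x)))
          in T.μ w , FP.respˡ (μμ⁻¹ z) (T.μ-⊕ {z⁻} {x} {w} e) , μ-h-⌈⌉ inv {w} {x} w∈h)
    }
    where
    open E.TRTConditions c
    h⁻ : ∀ {z} → z ∈ F.h F.⌈ proj₁ (T.μ x) ⌉ → T⁻¹.μ z ∈ E.h x̂
    h⁻ {z} z≤ = E.≤-resp-≈ E.refl (EP.⌈⌉-cong (μ⁻¹μ x))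
      (μ-h-⌈⌉ (swap inv) {z} {T.μ x} z≤)

  -- For meager m and n with sharp sum r one has n = m̂ ⊖ m, which the triple
  -- recognises.
  meager-sum-sharp : ∀ m n r → proj₁ m E.⊕ proj₁ n ⇓ proj₁ r →
                     proj₁ (T.μ m) F.⊕ proj₁ (T.μ n) ⇓ proj₁ (T.σ r)
  meager-sum-sharp m n r e =
    F.⊕-resp-≈ F.refl (T.μ-cong {_ , E.TRTConditions.y∈M c} {n} E.refl)
      (F.trans (F.sym (σ-⌈⌉ inv m)) (T.σ-cong {E.⌈ proj₁ m ⌉} {r} (E.sym r≈m̂)))
      (Equivalence.to (F.trt (T.μ m) _) (TRTConditions-μ m c))
    where
    r≈m̂ = EP.meager-⊕-sharp (proj₂ n) (proj₂ r) e
    -- Condition (2) is used twice: in `E` because the complement of `m` in its cover satisfies the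
    -- conditions, in `F` because nothing else does.
    c : E.TRTConditions m (proj₁ n)
    c = Equivalence.from (E.trt m (proj₁ n)) (EP.respᵒ r≈m̂ e)

  module _ (axioms : ClassicalAxioms) where

    -- The refinement matrix is mapped entrywise. Its first column has a sharp sum and is handled by
    -- `meager-sum-sharp`; the rows and the second column are sums in `M`.
    μ-sum : ∀ m n {x} → proj₁ m E.⊕ proj₁ n ⇓ x →
            proj₁ (T.μ m) F.⊕ proj₁ (T.μ n) ⇓ T.to x
    μ-sum m n {x} e =
      FP.⊕-interchange
        (meager-sum-sharp m₁ n₁ E.⌊ x ⌋ x₁⊕y₁)
        (T.μ-⊕ {m₂} {n₂} {EP.meagerPart x} x₂⊕y₂)
        (T.to-⊕ x)
        (T.μ-⊕ {m₁} {m₂} {m} x₁⊕x₂)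
        (T.μ-⊕ {n₁} {n₂} {n} y₁⊕y₂)
      where
      open EP.Refinement (EP.⊕-refinement axioms e)
      m₁ m₂ n₁ n₂ : E.M.Carrier
      m₁ = _ , EP.Meager-≤ (EP.⇓⇒≤ˡ x₁⊕x₂) (proj₂ m)
      m₂ = _ , EP.Meager-≤ (EP.⇓⇒≤ʳ x₁⊕x₂) (proj₂ m)
      n₁ = _ , EP.Meager-≤ (EP.⇓⇒≤ˡ y₁⊕y₂) (proj₂ n)
      n₂ = _ , EP.Meager-≤ (EP.⇓⇒≤ʳ y₁⊕y₂) (proj₂ n)

    -- The sharp parts add up in `S`. The sum of the meager parts need not be meager, which is why
    -- `μ-sum` gives its image as a value of `to`.
    to-⊕-homo : ∀ {x y z} → x E.⊕ y ⇓ z → T.to x F.⊕ T.to y ⇓ T.to z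
    to-⊕-homo {x} {y} e =
      let st , mn , s⊕t , m⊕n , st⊕mn = EP.interchange (EP.⌊⌋-⊕ x) (EP.⌊⌋-⊕ y) e
          stₛ = st , EP.Sharp-⊕ E.homogeneous (proj₂ E.⌊ x ⌋) (proj₂ E.⌊ y ⌋) s⊕t
      in FP.⊕-interchange (T.σ-⊕ {E.⌊ x ⌋} {E.⌊ y ⌋} {stₛ} s⊕t)
           (μ-sum (EP.meagerPart x) (EP.meagerPart y) m⊕n) (T.σ-⊕-to stₛ st⊕mn)
           (T.to-⊕ x) (T.to-⊕ y)

    to-preserves : IsEffectAlgebraMorphism E.rawEffectAlgebra F.rawEffectAlgebra T.to
    to-preserves = record
      { cong   = T.to-cong
      ; 1-homo = FP.⊕-cong T.σ-1 T.μ-0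
          (T.to-unique E.S.1# E.M.0# (E.⊕-identityʳ E.1#)) (F.⊕-identityʳ F.1#)
      ; ⊕-homo = to-⊕-homo
      }

triple⇒≅ : ClassicalAxioms → ∀ {ℓ} {E F : TRTEffectAlgebra ℓ} → TripleIsomorphism E F → E ≅ F
triple⇒≅ axioms {E = E} {F} τ = record
  { to              = T.to
  ; from            = T⁻¹.to
  ; to-isMorphism   = to-preserves inv axioms
  ; from-isMorphism = to-preserves (swap inv) axioms
  ; inverse         =
      (λ e → F.trans (T.to-cong e) (from-to (swap inv) _)) ,
      (λ e → E.trans (T⁻¹.to-cong e) (from-to inv _))
  }
  where
  module E = TRTEffectAlgebra E
  module F = TRTEffectAlgebra F
  module T = TripleMap τ
  module T⁻¹ = TripleMap (invert τ)
  inv = invert-inverses τ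

-- Restriction of isomorphisms to sharp and meager elements

module _ {ℓ} {A B : RawEffectAlgebra ℓ} where

  inverse-isomorphism : EffectAlgebraIsomorphism A B → EffectAlgebraIsomorphism B A
  inverse-isomorphism iso = record
    { to              = from
    ; from            = to
    ; to-isMorphism   = from-isMorphism
    ; from-isMorphism = to-isMorphism
    ; inverse         = proj₂ inverse , proj₁ inverse
    }
    where open EffectAlgebraIsomorphism iso

module SharpImage {ℓ} (E F : EffectAlgebra ℓ)
  (iso : EffectAlgebraIsomorphism (EffectAlgebra.rawEffectAlgebra E)
                                  (EffectAlgebra.rawEffectAlgebra F)) where

  private
    module E = EffectAlgebra E
    module F = EffectAlgebra F
    module EP = EffectAlgebraProperties E
    module FP = EffectAlgebraProperties F
  open EffectAlgebraIsomorphism iso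
  private
    module to   = IsEffectAlgebraMorphism to-isMorphism
    module from = IsEffectAlgebraMorphism from-isMorphism

  to∘from : ∀ y → to (from y) F.≈ y
  to∘from y = proj₁ inverse E.refl

  from∘to : ∀ x → from (to x) E.≈ x
  from∘to x = proj₂ inverse F.refl

  to-≤ : ∀ {x y} → x E.≤ y → to x F.≤ to y
  to-≤ (_ , e) = _ , to.⊕-homo e

  from-≤ : ∀ {x y} → x F.≤ to y → from x E.≤ y
  from-≤ (_ , e) = _ , EP.respᵒ (from∘to _) (from.⊕-homo e)

  -- Morphisms are only required to preserve `1#` and sums, so this comes from `0# ⊕ 0# = 0#` by
  -- cancellation.
  to-0 : to E.0# F.≈ F.0#
  to-0 = FP.⊕-cancelˡ (to.⊕-homo (E.⊕-identityʳ E.0#)) (F.⊕-identityʳ _)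

  to-′ : ∀ x → to (x E.′) F.≈ to x F.′
  to-′ x = F.sym (F.′-unique (FP.respᵒ to.1-homo (to.⊕-homo (E.′-⊕ x))))

  from-≈0⇒≈0 : ∀ {w} → from w E.≈ E.0# → w F.≈ F.0#
  from-≈0⇒≈0 {w} e = F.trans (F.sym (to∘from w)) (F.trans (to.cong e) to-0)

  to-Sharp : ∀ {x} → x ∈ E.Sharp → to x ∈ F.Sharp
  to-Sharp {x} s = FP.Sharp-intro λ w≤x w≤x′ → from-≈0⇒≈0
    (E.≤0⇒≈0 (E.IsMeet.greatest s (from-≤ w≤x)
      (from-≤ (F.≤-resp-≈ F.refl (F.sym (to-′ x)) w≤x′))))

module SharpMeagerImage {ℓ} (E F : EffectAlgebra ℓ)
  (iso : EffectAlgebraIsomorphism (EffectAlgebra.rawEffectAlgebra E)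
                                  (EffectAlgebra.rawEffectAlgebra F)) where

  private
    module E = EffectAlgebra E
    module F = EffectAlgebra F
    module Inverse = SharpImage F E (inverse-isomorphism iso)
  open EffectAlgebraIsomorphism iso
  open SharpImage E F iso public

  from-Sharp : ∀ {y} → y ∈ F.Sharp → from y ∈ E.Sharp
  from-Sharp = Inverse.to-Sharp

  -- A sharp element below `to x` is pulled back to a sharp element below `x`. This needs `from` to
  -- preserve sharpness, so sharp elements are treated first, for both directions.
  to-Meager : ∀ {x} → x ∈ E.Meager → to x ∈ F.Meager
  to-Meager m s v≤ = from-≈0⇒≈0 (m (from-Sharp s) (from-≤ v≤))

≅⇒triple : ∀ {ℓ} (E F : TRTEffectAlgebra ℓ) → E ≅ F → TripleIsomorphism E F
≅⇒triple E F iso = record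
  { σ = record
    { to              = λ (x , s) → to x , to-Sharp s
    ; from            = λ (y , s) → from y , from-Sharp s
    ; to-isMorphism   = record
      { cong = to.cong ; 1-homo = to.1-homo ; ⊕-homo = to.⊕-homo }
    ; from-isMorphism = record
      { cong = from.cong ; 1-homo = from.1-homo ; ⊕-homo = from.⊕-homo }
    ; inverse         = proj₁ inverse , proj₂ inverse
    }
  ; μ = record
    { to        = λ (x , m) → to x , to-Meager m
    ; cong      = to.cong
    ; bijective =
        (λ e → E.trans (E.sym (from∘to _)) (E.trans (from.cong e) (from∘to _))) ,
        (λ (y , m) → (from y , from-Meager m) , proj₁ inverse)
    ; 0-homo    = to-0
    ; ⊕-defined = λ _ _ → mk⇔
        (λ ((z , m) , e) → (to z , to-Meager m) , to.⊕-homo e)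
        (λ ((z , m) , e) → (from z , from-Meager m) ,
          E.⊕-resp-≈ (from∘to _) (from∘to _) E.refl (from.⊕-homo e))
    ; ⊕-homo    = to.⊕-homo
    }
  ; h-compatible = λ s →
      (λ (_ , x≤s , e) → F.≤-resp-≈ e F.refl (to-≤ x≤s)) ,
      (λ {(y , m)} y≤ → (from y , from-Meager m) , from-≤ y≤ , to∘from y)
  }
  where
  module E = TRTEffectAlgebra E
  module F = TRTEffectAlgebra F
  open EffectAlgebraIsomorphism iso
  module to   = IsEffectAlgebraMorphism to-isMorphism
  module from = IsEffectAlgebraMorphism from-isMorphism
  open SharpMeagerImage E.effectAlgebra F.effectAlgebra iso
  open SharpMeagerImage F.effectAlgebra E.effectAlgebra (inverse-isomorphism iso)
    using () renaming (to-Meager to from-Meager)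

mainTheorem1 : ClassicalAxioms → ∀ {ℓ} (E F : TRTEffectAlgebra ℓ) → E ≅ F ⇔ TripleIsomorphism E F
mainTheorem1 axioms E F = mk⇔ (≅⇒triple E F) (triple⇒≅ axioms)
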